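{- Let $k\ge1$ be the number of pivots and $m=\lceil (k+1)/2\rceil$. Then for Algorithm $\mathrm{Exchange}_k$, $$\mathrm{E}(P^{se}_n)=\begin{cases}\frac{m+1}{2}\, n+O(1),&k\text{ odd},\\ \frac{m^2}{2m-1}\, n+O(1),&k\text{ even},\end{cases}\qquad \mathrm{E}(P^{wa}_n)=\begin{cases}\frac{2m^3+3m^2-m-2}{2m(2m+1)}\, n+O(1),&k\text{ odd},\\ \frac{2m^3-2m-1}{2m(2m-1)}\, n+O(1),&k\text{ even},\end{cases}$$ $$\mathrm{E}(P^{as}_n)=\begin{cases}\frac{2m^3+6m^2-m-4}{2m(2m+1)}\, n+O(1),&k\text{ odd},\\ \frac{2m^3+3m^2-5m-2}{2m(2m-1)}\, n+O(1),&k\text{ even}.\end{cases}$$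
   Context: Input: an array $A[1..n]$ containing a uniformly random permutation of $\{1,\dots,n\}$. The first $k$ cells are used to determine the pivots $p_1<\dots<p_k$ (the sorted values of $A[1..k]$), with $p_0=0,p_{k+1}=n+1$; each element $x$ in $A[k+1..n]$ belongs to group $A_h$ where $p_h<x<p_{h+1}$, and its group is assumed known at no cost. The operation $\mathrm{rotate}(i_1,\dots,i_\ell)$ performs $\mathrm{tmp}\gets A[i_1];A[i_1]\gets A[i_2];\dots;A[i_{\ell-1}]\gets A[i_\ell];A[i_\ell]\gets\mathrm{tmp}$. Algorithm $\mathrm{Exchange}_k$: set $i\gets k+1$, $j\gets n$, $m\gets\lceil (k+1)/2\rceil$, $b_1,\dots,b_{m-1}\gets i$, $b_m,\dots,b_{k-1}\gets j$. While $i<j$: (1) while $A[i]$ belongs to a group $A_p$ with $p<m$: if $p<m-1$, perform $\mathrm{rotate}(i,b_{m-1},\dots,b_{p+1})$ and increment $b_{p+1},\dots,b_{m-1}$ by one; then increment $i$. (2) While $A[j]$ belongs to a group $A_q$ with $q\ge m$: if $q\ge m+1$, perform $\mathrm{rotate}(j,b_m,\dots,b_{q-1})$ and decrement $b_{q-1},\dots,b_m$ by one; then decrement $j$. (3) If $i<j$ (now $A[i]\in A_p$ with $p\ge m$ and $A[j]\in A_q$ with $q<m$): perform $\mathrm{rotate}(i,b_{m-1},\dots,b_{q+1},j,b_m,\dots,b_{p-1})$; increment $i,b_{q+1},\dots,b_{m-1}$; decrement $j,b_m,\dots,b_{p-1}$. Cost measures for one partitioning step: $P^{se}_n$ (scanned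 elements) is the sum over the pointers $i,j,b_1,\dots,b_{k-1}$ of $|\text{final value}-\text{initial value}|$; $P^{wa}_n$ (write accesses) is the sum over all rotate operations of the number $\ell$ of cells involved; $P^{as}_n$ (assignments) is the sum over all rotate operations of $\ell+1$. Expectations are over the random input. -}

module Defs where

open import Data.Bool using (Bool; true; false; if_then_else_; _∧_)
open import Data.Nat using (ℕ; zero; suc; _+_; _*_; _∸_; _<ᵇ_; _≤ᵇ_; _≡ᵇ_; ∣_-_∣; ⌈_/2⌉)
open import Data.List using (List; []; _∷_; map; concatMap; upTo; reverse; length; _++_)
open import Data.Nat.ListAction using (sum)
open import Data.Integer using (ℤ; +_)
import Data.Rational as ℚ
open ℚ using (ℚ)

-- Uniformly random permutations: the list of all permutations of a list
-- (each permutation of {1..n} occurs exactly once in allPerms n).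

insAll : ℕ → List ℕ → List (List ℕ)
insAll x []       = (x ∷ []) ∷ []
insAll x (y ∷ ys) = (x ∷ y ∷ ys) ∷ map (y ∷_) (insAll x ys)

perms : List ℕ → List (List ℕ)
perms []       = [] ∷ []
perms (x ∷ xs) = concatMap (insAll x) (perms xs)

allPerms : ℕ → List (List ℕ)
allPerms n = perms (map suc (upTo n))

-- Arrays are functions ℕ → ℕ (1-indexed); cells outside 1..n hold 0.

Arr : Set
Arr = ℕ → ℕ

nth : List ℕ → ℕ → ℕ
nth []       _       = 0
nth (x ∷ xs) zero    = x
nth (x ∷ xs) (suc t) = nth xs t

toArr : List ℕ → Arr
toArr xs t = nth xs (t ∸ 1)

set : Arr → ℕ → ℕ → Arr
set A p v x = if x ≡ᵇ p then v else A x

-- rotate(i_1,...,i_l) executed sequentially as written: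
-- tmp ← A[i_1]; A[i_1] ← A[i_2]; ...; A[i_{l-1}] ← A[i_l]; A[i_l] ← tmp
rotGo : ℕ → Arr → ℕ → List ℕ → Arr
rotGo tmp A cur []         = set A cur tmp
rotGo tmp A cur (nx ∷ rest) = rotGo tmp (set A cur (A nx)) nx rest

rotate : Arr → List ℕ → Arr
rotate A []       = A
rotate A (i ∷ is) = rotGo (A i) A i is

-- ranges [lo, lo+1, ..., hi] and [hi, hi-1, ..., lo] (empty if hi < lo)
asc : ℕ → ℕ → List ℕ
asc lo hi = map (λ t → lo + t) (upTo (suc hi ∸ lo))

desc : ℕ → ℕ → List ℕ
desc hi lo = reverse (asc lo hi)

inRange : ℕ → ℕ → ℕ → Bool
inRange lo hi t = (lo ≤ᵇ t) ∧ (t ≤ᵇ hi)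

incr : (ℕ → ℕ) → ℕ → ℕ → (ℕ → ℕ)
incr b lo hi t = if inRange lo hi t then suc (b t) else b t

decr : (ℕ → ℕ) → ℕ → ℕ → (ℕ → ℕ)
decr b lo hi t = if inRange lo hi t then b t ∸ 1 else b t

-- Groups. The pivots are the values A0[1..k] of the input array; an
-- element x (not a pivot) is in group A_h with h = #{pivots < x}.

countLess : Arr → ℕ → ℕ → ℕ
countLess A0 x zero    = 0
countLess A0 x (suc t) = (if A0 (suc t) <ᵇ x then 1 else 0) + countLess A0 x t

group : ℕ → Arr → ℕ → ℕ
group k A0 x = countLess A0 x k

mOf : ℕ → ℕ
mOf k = ⌈ suc k /2⌉

record State : Set where
  constructor st
  field
    arr : Arr
    pi  : ℕ
    pj  : ℕ
    pb  : ℕ → ℕ      -- pointers b_1, ..., b_{k-1}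
    wa  : ℕ          -- write accesses so far
    as  : ℕ          -- assignments so far

data Phase : Set where
  outer loop1 loop2 step3 : Phase

module Exchange (k : ℕ) (A0 : Arr) where
  m : ℕ
  m = mOf k

  grp : ℕ → ℕ
  grp = group k A0

  body1 : State → State
  body1 (st A i j b w a) =
    let p = grp (A i) in
    if suc p <ᵇ m
      then (let idx = i ∷ map b (desc (m ∸ 1) (suc p))
                l   = length idx in
            st (rotate A idx) (suc i) j (incr b (suc p) (m ∸ 1)) (w + l) (a + suc l))
      else st A (suc i) j b w a

  body2 : State → State
  body2 (st A i j b w a) =
    let q = grp (A j) in
    if m <ᵇ q
      then (let idx = j ∷ map b (asc m (q ∸ 1))
                l   = length idx in
            st (rotate A idx) i (j ∸ 1) (decr b m (q ∸ 1)) (w + l) (a + suc l))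
      else st A i (j ∸ 1) b w a

  body3 : State → State
  body3 (st A i j b w a) =
    let p   = grp (A i)
        q   = grp (A j)
        idx = (i ∷ map b (desc (m ∸ 1) (suc q))) ++ (j ∷ map b (asc m (p ∸ 1)))
        l   = length idx in
    st (rotate A idx) (suc i) (j ∸ 1) (decr (incr b (suc q) (m ∸ 1)) m (p ∸ 1))
       (w + l) (a + suc l)

  -- the loops; the inner loops (1),(2) additionally stop once i > j
  run : ℕ → Phase → State → State
  run zero    _     s = s
  run (suc f) outer s =
    if State.pi s <ᵇ State.pj s then run f loop1 s else s
  run (suc f) loop1 s =
    if (State.pi s ≤ᵇ State.pj s) ∧ (grp (State.arr s (State.pi s)) <ᵇ m)
      then run f loop1 (body1 s) else run f loop2 s
  run (suc f) loop2 s =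
    if (State.pi s ≤ᵇ State.pj s) ∧ (m ≤ᵇ grp (State.arr s (State.pj s)))
      then run f loop2 (body2 s) else run f step3 s
  run (suc f) step3 s =
    if State.pi s <ᵇ State.pj s then run f outer (body3 s) else run f outer s

  initB : ℕ → ℕ → ℕ
  initB n t = if t <ᵇ m then suc k else n

  init : ℕ → State
  init n = st A0 (suc k) n (initB n) 0 0

  -- fuel 10(n+2) exceeds the number of loop iterations (≤ 5(n+2))
  final : ℕ → State
  final n = run (10 * (n + 2)) outer (init n)

  sumTo : (ℕ → ℕ) → ℕ → ℕ
  sumTo f zero    = 0
  sumTo f (suc t) = f (suc t) + sumTo f t

  -- scanned elements: Σ over pointers i, j, b_1..b_{k-1} of |final - initial|
  costSE : ℕ → ℕ
  costSE n =
    let s = final n in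
    ∣ State.pi s - suc k ∣ + ∣ State.pj s - n ∣
      + sumTo (λ t → ∣ State.pb s t - initB n t ∣) (k ∸ 1)

  costWA : ℕ → ℕ
  costWA n = State.wa (final n)

  costAS : ℕ → ℕ
  costAS n = State.as (final n)

-- cost of one partitioning step of Exchange_k on input permutation xs of {1..n}
PSE PWA PAS : ℕ → ℕ → List ℕ → ℕ
PSE k n xs = Exchange.costSE k (toArr xs) n
PWA k n xs = Exchange.costWA k (toArr xs) n
PAS k n xs = Exchange.costAS k (toArr xs) n

mean : List ℕ → ℚ
mean []       = ℚ.0ℚ
mean (x ∷ xs) = (+ sum (x ∷ xs)) ℚ./ suc (length xs)

E : (ℕ → ℕ → List ℕ → ℕ) → ℕ → ℕ → ℚ
E P k n = mean (map (P k n) (allPerms n))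

LinPlusO1 : (ℕ → ℚ) → ℚ → Set
LinPlusO1 f c = Σ ℚ λ C → Σ ℕ λ N → ∀ n → N ≤ n → ℚ.∣ f n ℚ.- c ℚ.* (+ n ℚ./ 1) ∣ ℚ.≤ C
  where
  open import Data.Product using (Σ)
  open import Data.Nat using (_≤_)

-- the rational number a/d (d > 0 in all uses below)
frac : ℤ → ℕ → ℚ
frac a zero    = ℚ.0ℚ
frac a (suc d) = a ℚ./ suc d

{-# OPTIONS --safe #-}
-- Placing an element of group g moves w(g) pointers, whichever pointer reads it, so the
-- number of scanned elements is, up to O(1), the sum of w over the groups of all non-pivots.
-- A placement also writes w(g) cells, except that an element of group m-1 read from the left
-- or of group m read from the right stays where it is; and every swap merges the placement of
-- a right element read from the left with that of a left element read from the right.  The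
-- left pointer reads, up to O(1), the first ℓ non-pivot positions, where ℓ is the number of
-- elements of groups below m.  As ℓ is symmetric in the non-pivot positions, the expected
-- number of elements of a class among these positions is E(ℓ · size of the class)/(n-k).
-- The ranks of the entries k+1 and k+2 among their predecessors are independent and uniform,
-- which gives the joint law of the groups of two non-pivots and hence these moments.
module Submission where

open import Defs

-- A rotation writes only to the cells under `i` and `j` and to cells already read, so every element
-- is read from the place it has in the input. The groups met are those of the input, and the costs
-- depend only on which elements each pointer reads. Only swaps let `i` pass a right element and `j`
-- a left one, and each swap does both once. Hence the number of cells read by `i` equals the number
-- of left elements read by either pointer; since at most one element stays unread, this is why the
-- left pointer stops near ℓ. Assignments exceed write accesses by the number of rotations, that is,
-- the reads minus the elements that stay in place minus the swaps. Expectations are handled as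
-- natural-number sums over all permutations, with negative terms moved to the other side and
-- denominators cleared. The common denominator is `(k+1)(k+2)`, the number of equally likely pairs
-- of ranks for two successive entries; it equals `2m(2m+1)` for odd `k` and `2m(2m-1)` for even
-- `k`.

module Analysis where

  open import Data.Bool using (Bool; true; false; if_then_else_; T; _∧_)
  open import Data.Bool.Properties using (T-∧)
  open import Data.Empty using (⊥-elim)
  open import Data.Integer as ℤ using (ℤ)
  import Data.Integer.Properties as ℤ
  import Data.Integer.Tactic.RingSolver as ℤ-Ring
  open import Data.List using (List; []; _∷_; map; concatMap; upTo; length; _++_)
  open import Data.List.Properties using (map-++; map-∘; length-map; length-upTo; length-reverse; length-++)
  open import Data.List.Relation.Binary.Permutation.Propositional using (↭-sym)
  open import Data.List.Relation.Binary.Permutation.Propositional.Properties using (↭-reverse; All-resp-↭)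
  open import Data.List.Relation.Unary.All as All using (All; []; _∷_)
  import Data.List.Relation.Unary.All.Properties as All
  open import Data.List.Relation.Unary.AllPairs using ([]; _∷_)
  open import Data.List.Relation.Unary.Unique.Propositional using (Unique)
  import Data.List.Relation.Unary.Unique.Propositional.Properties as Unique
  open import Data.Nat
  open import Data.Nat.ListAction using (sum)
  open import Data.Nat.ListAction.Properties using (sum-++)
  open import Data.Nat.Properties
  open import Data.Nat.Tactic.RingSolver using (solve-∀)
  open import Data.Product using (Σ; ∃; ∃₂; _×_; _,_; proj₁; proj₂)
  import Data.Rational as ℚ
  import Data.Rational.Properties as ℚ
  open import Data.Rational.Unnormalised as ℚᵘ using (mkℚᵘ; *≤*)
  import Data.Rational.Unnormalised.Properties as ℚᵘ
  open import Data.Sum using (_⊎_; inj₁; inj₂)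
  open import Data.Unit using (tt)
  open import Function using (_∘_; id)
  open import Function.Bundles using (Equivalence)
  open import Relation.Binary.Definitions using (tri<; tri≈; tri>)
  open import Relation.Binary.PropositionalEquality
  open import Relation.Nullary using (¬_; yes; no)

  -- Finite sums and transpositions

  opaque
    ∑ : ℕ → (ℕ → ℕ) → ℕ
    ∑ zero    f = 0
    ∑ (suc n) f = f n + ∑ n f

    ∑-cong : ∀ n {f g : ℕ → ℕ} → (∀ t → t < n → f t ≡ g t) → ∑ n f ≡ ∑ n g
    ∑-cong zero    e = refl
    ∑-cong (suc n) e = cong₂ _+_ (e n ≤-refl) (∑-cong n (λ t t<n → e t (m≤n⇒m≤1+n t<n)))

    +-interchange : ∀ a b c d → (a + b) + (c + d) ≡ (a + c) + (b + d)
    +-interchange = solve-∀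

    ∑-+ : ∀ n (f g : ℕ → ℕ) → ∑ n (λ t → f t + g t) ≡ ∑ n f + ∑ n g
    ∑-+ zero    f g = refl
    ∑-+ (suc n) f g = trans (cong (f n + g n +_) (∑-+ n f g)) (+-interchange (f n) (g n) (∑ n f) (∑ n g))

    ∑-*ˡ : ∀ n c (f : ℕ → ℕ) → ∑ n (λ t → c * f t) ≡ c * ∑ n f
    ∑-*ˡ zero    c f = sym (*-zeroʳ c)
    ∑-*ˡ (suc n) c f = trans (cong (c * f n +_) (∑-*ˡ n c f)) (sym (*-distribˡ-+ c (f n) (∑ n f)))

    ∑-*ʳ : ∀ n c (f : ℕ → ℕ) → ∑ n (λ t → f t * c) ≡ ∑ n f * c
    ∑-*ʳ zero    c f = refl
    ∑-*ʳ (suc n) c f = trans (cong (f n * c +_) (∑-*ʳ n c f)) (sym (*-distribʳ-+ c (f n) (∑ n f)))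

    ∑-const : ∀ n c → ∑ n (λ _ → c) ≡ n * c
    ∑-const zero    c = refl
    ∑-const (suc n) c = cong (c +_) (∑-const n c)

    ∑-zero : ∀ n → ∑ n (λ _ → 0) ≡ 0
    ∑-zero zero    = refl
    ∑-zero (suc n) = ∑-zero n

    ∑-mono : ∀ n {f g : ℕ → ℕ} → (∀ t → t < n → f t ≤ g t) → ∑ n f ≤ ∑ n g
    ∑-mono zero    e = z≤n
    ∑-mono (suc n) e = +-mono-≤ (e n ≤-refl) (∑-mono n (λ t t<n → e t (m≤n⇒m≤1+n t<n)))

    ∑-comm : ∀ a b (f : ℕ → ℕ → ℕ) → ∑ a (λ s → ∑ b (f s)) ≡ ∑ b (λ t → ∑ a (λ s → f s t))
    ∑-comm zero    b f = sym (∑-zero b)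
    ∑-comm (suc a) b f = trans (cong (∑ b (f a) +_) (∑-comm a b f)) (sym (∑-+ b (f a) _))

  opaque
    unfolding ∑

    ∑-split : ∀ a b (f : ℕ → ℕ) → ∑ (a + b) f ≡ ∑ a f + ∑ b (λ t → f (a + t))
    ∑-split a zero    f = trans (cong (λ c → ∑ c f) (+-identityʳ a)) (sym (+-identityʳ _))
    ∑-split a (suc b) f = trans (cong (λ c → ∑ c f) (+-suc a b))
      (trans (cong (f (a + b) +_) (∑-split a b f)) (lem (f (a + b)) (∑ a f) _))
      where
      lem : ∀ x y z → x + (y + z) ≡ y + (x + z)
      lem = solve-∀

  χ : Bool → ℕ
  χ b = if b then 1 else 0

  χ≤1 : ∀ b → χ b ≤ 1
  χ≤1 true  = ≤-refl
  χ≤1 false = z≤n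

  χ-true : ∀ {b} → T b → χ b ≡ 1
  χ-true {true} _ = refl

  χ-false : ∀ {b} → ¬ T b → χ b ≡ 0
  χ-false {false} _ = refl
  χ-false {true}  h = ⊥-elim (h _)

  ≡ᵇ-no : ∀ {a b} → a ≢ b → χ (a ≡ᵇ b) ≡ 0
  ≡ᵇ-no {a} {b} ne = χ-false (ne ∘ ≡ᵇ⇒≡ a b)

  ≡ᵇ-yes : ∀ {a b} → a ≡ b → χ (a ≡ᵇ b) ≡ 1
  ≡ᵇ-yes {a} {b} e = χ-true (≡⇒≡ᵇ a b e)

  <ᵇ-yes : ∀ {a b} → a < b → χ (a <ᵇ b) ≡ 1
  <ᵇ-yes = χ-true ∘ <⇒<ᵇ

  <ᵇ-no : ∀ {a b} → b ≤ a → χ (a <ᵇ b) ≡ 0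
  <ᵇ-no {a} {b} b≤a = χ-false (≤⇒≯ b≤a ∘ <ᵇ⇒< a b)

  opaque
    unfolding ∑

    ∑-δ : ∀ n u (f : ℕ → ℕ) → u < n → ∑ n (λ t → χ (u ≡ᵇ t) * f t) ≡ f u
    ∑-δ (suc n) u f u<1+n with u ≟ n
    ... | yes refl rewrite ≡ᵇ-yes {u} refl =
      trans (cong (f u + 0 +_) (trans (∑-cong u (λ t t<u → cong (_* f t) (≡ᵇ-no (≢-sym (<⇒≢ t<u))))) (∑-zero u)))
            (trans (+-identityʳ _) (+-identityʳ _))
    ... | no u≢n rewrite ≡ᵇ-no u≢n = ∑-δ n u f (≤∧≢⇒< (≤-pred u<1+n) u≢n)

  tr : ℕ → ℕ → ℕ → ℕ
  tr u v t with t ≟ u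
  ... | yes _ = v
  ... | no  _ with t ≟ v
  ...   | yes _ = u
  ...   | no  _ = t

  tr-l : ∀ u v → tr u v u ≡ v
  tr-l u v with u ≟ u
  ... | yes _ = refl
  ... | no  h = ⊥-elim (h refl)

  tr-r : ∀ u v → tr u v v ≡ u
  tr-r u v with v ≟ u
  ... | yes e = e
  ... | no  _ with v ≟ v
  ...   | yes _ = refl
  ...   | no  h = ⊥-elim (h refl)

  tr-o : ∀ u v t → t ≢ u → t ≢ v → tr u v t ≡ t
  tr-o u v t p q with t ≟ u
  ... | yes e = ⊥-elim (p e)
  ... | no  _ with t ≟ v
  ...   | yes e = ⊥-elim (q e)
  ...   | no  _ = refl

  tr-cases : ∀ u v t → (t ≡ u × tr u v t ≡ v) ⊎ (t ≡ v × tr u v t ≡ u) ⊎ (t ≢ u × t ≢ v × tr u v t ≡ t)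
  tr-cases u v t with t ≟ u
  ... | yes e = inj₁ (e , refl)
  ... | no  p with t ≟ v
  ...   | yes e = inj₂ (inj₁ (e , refl))
  ...   | no  q = inj₂ (inj₂ (p , q , refl))

  tr-id : ∀ u t → tr u u t ≡ t
  tr-id u t with tr-cases u u t
  ... | inj₁ (e , q)               = trans q (sym e)
  ... | inj₂ (inj₁ (e , q))        = trans q (sym e)
  ... | inj₂ (inj₂ (_ , _ , q)) = q

  tr-sym : ∀ u v t → tr u v t ≡ tr v u t
  tr-sym u v t with tr-cases u v t
  ... | inj₁ (refl , q)            = trans q (sym (tr-r v t))
  ... | inj₂ (inj₁ (refl , q))     = trans q (sym (tr-l t u))
  ... | inj₂ (inj₂ (a , b , q)) = trans q (sym (tr-o v u t b a))

  tr-suc : ∀ u v t → tr (suc u) (suc v) (suc t) ≡ suc (tr u v t)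
  tr-suc u v t with tr-cases u v t
  ... | inj₁ (refl , q)            = trans (tr-l (suc t) (suc v)) (cong suc (sym q))
  ... | inj₂ (inj₁ (refl , q))     = trans (tr-r (suc u) (suc t)) (cong suc (sym q))
  ... | inj₂ (inj₂ (a , b , q)) = trans (tr-o (suc u) (suc v) (suc t) (a ∘ suc-injective) (b ∘ suc-injective)) (cong suc (sym q))

  tr-shift : ∀ k u v t → tr (k + u) (k + v) (k + t) ≡ k + tr u v t
  tr-shift zero    u v t = refl
  tr-shift (suc k) u v t = trans (tr-suc (k + u) (k + v) (k + t)) (cong suc (tr-shift k u v t))

  -- Conjugation by an adjacent transposition moves one end of a transposition by one place.
  -- Repeating this reduces every transposition to adjacent ones, the only ones that follow the
  -- recursive generation of permutations.
  tr-conj : ∀ u v t → u < v → tr v (suc v) (tr u v (tr v (suc v) t)) ≡ tr u (suc v) t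
  tr-conj u v t u<v with tr-cases v (suc v) t
  ... | inj₁ (refl , q) rewrite q | tr-o u t (suc t) (>⇒≢ (m<n⇒m<1+n u<v)) (>⇒≢ ≤-refl)
          | tr-r t (suc t) = sym (tr-o u (suc t) t (>⇒≢ u<v) (<⇒≢ ≤-refl))
  ... | inj₂ (inj₁ (refl , q)) rewrite q | tr-r u v | tr-o v (suc v) u (<⇒≢ u<v) (<⇒≢ (m<n⇒m<1+n u<v))
          = sym (tr-r u (suc v))
  ... | inj₂ (inj₂ (a , b , q)) with tr-cases u (suc v) t
  ...   | inj₁ (refl , q′) rewrite q | q′ | tr-l t v = tr-l v (suc v)
  ...   | inj₂ (inj₁ (e , _)) = ⊥-elim (b e)
  ...   | inj₂ (inj₂ (t≢u , _ , q′)) rewrite q | q′ | tr-o u v t t≢u a = tr-o v (suc v) t a b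

  -- Once `f u + f v` is added to both sides and written as point masses at `u` and `v`, the two
  -- sums agree term by term, so the range need not be cut at `u` and `v`.
  ∑-tr : ∀ n u v (f : ℕ → ℕ) → u < n → v < n → ∑ n (f ∘ tr u v) ≡ ∑ n f
  ∑-tr n u v f u<n v<n = +-cancelʳ-≡ (f u + f v) (∑ n (f ∘ tr u v)) (∑ n f) (begin
    ∑ n (f ∘ tr u v) + (f u + f v)
      ≡⟨ cong (∑ n (f ∘ tr u v) +_) (sym (cong₂ _+_ (∑-δ n u (λ _ → f u) u<n) (∑-δ n v (λ _ → f v) v<n))) ⟩
    ∑ n (f ∘ tr u v) + (∑ n (δ u u) + ∑ n (δ v v))
      ≡⟨ cong (∑ n (f ∘ tr u v) +_) (sym (∑-+ n (δ u u) (δ v v))) ⟩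
    ∑ n (f ∘ tr u v) + ∑ n (λ t → δ u u t + δ v v t)
      ≡⟨ sym (∑-+ n (f ∘ tr u v) _) ⟩
    ∑ n (λ t → f (tr u v t) + (δ u u t + δ v v t))
      ≡⟨ ∑-cong n (λ t _ → pointwise t) ⟩
    ∑ n (λ t → f t + (δ u v t + δ v u t))
      ≡⟨ ∑-+ n f _ ⟩
    ∑ n f + ∑ n (λ t → δ u v t + δ v u t)
      ≡⟨ cong (∑ n f +_) (∑-+ n (δ u v) (δ v u)) ⟩
    ∑ n f + (∑ n (δ u v) + ∑ n (δ v u))
      ≡⟨ cong (∑ n f +_) (cong₂ _+_ (∑-δ n u (λ _ → f v) u<n) (∑-δ n v (λ _ → f u) v<n)) ⟩
    ∑ n f + (f v + f u)
      ≡⟨ cong (∑ n f +_) (+-comm (f v) (f u)) ⟩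
    ∑ n f + (f u + f v) ∎)
    where
    open ≡-Reasoning
    δ : ℕ → ℕ → ℕ → ℕ
    δ a b t = χ (a ≡ᵇ t) * f b
    lem₁ : ∀ a b c → a + ((b + 0) + c) ≡ b + ((a + 0) + c)
    lem₁ = solve-∀
    lem₂ : ∀ a b → a + (0 + (b + 0)) ≡ b + (0 + (a + 0))
    lem₂ = solve-∀
    pointwise : ∀ t → f (tr u v t) + (δ u u t + δ v v t) ≡ f t + (δ u v t + δ v u t)
    pointwise t with u ≟ v
    ... | yes refl rewrite tr-id u t = refl
    ... | no u≢v with tr-cases u v t
    ...   | inj₁ (refl , q) rewrite q | ≡ᵇ-yes {t} refl | ≡ᵇ-no {v} {t} (≢-sym u≢v) = lem₁ (f v) (f t) 0
    ...   | inj₂ (inj₁ (refl , q)) rewrite q | ≡ᵇ-yes {t} refl | ≡ᵇ-no {u} {t} u≢v = lem₂ (f u) (f t)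
    ...   | inj₂ (inj₂ (a , b , q)) rewrite q | ≡ᵇ-no {u} {t} (≢-sym a) | ≡ᵇ-no {v} {t} (≢-sym b) = refl

  -- Sums over all permutations

  sumOver : List (List ℕ) → (List ℕ → ℕ) → ℕ
  sumOver xss F = sum (map F xss)

  sumOver-cong : ∀ {xss F H} → All (λ xs → F xs ≡ H xs) xss → sumOver xss F ≡ sumOver xss H
  sumOver-cong []       = refl
  sumOver-cong (e ∷ es) = cong₂ _+_ e (sumOver-cong es)

  sumOver-+ : ∀ xss F H → sumOver xss (λ xs → F xs + H xs) ≡ sumOver xss F + sumOver xss H
  sumOver-+ []         F H = refl
  sumOver-+ (xs ∷ xss) F H = trans (cong (F xs + H xs +_) (sumOver-+ xss F H)) (+-interchange (F xs) (H xs) _ _)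

  sumOver-*ʳ : ∀ xss c F → sumOver xss (λ xs → F xs * c) ≡ sumOver xss F * c
  sumOver-*ʳ []         c F = refl
  sumOver-*ʳ (xs ∷ xss) c F = trans (cong (F xs * c +_) (sumOver-*ʳ xss c F)) (sym (*-distribʳ-+ c (F xs) _))

  sumOver-zero : ∀ xss → sumOver xss (λ _ → 0) ≡ 0
  sumOver-zero []         = refl
  sumOver-zero (xs ∷ xss) = sumOver-zero xss

  sumOver-1 : ∀ xss → sumOver xss (λ _ → 1) ≡ length xss
  sumOver-1 []         = refl
  sumOver-1 (xs ∷ xss) = cong suc (sumOver-1 xss)

  opaque
    unfolding ∑

    sumOver-∑ : ∀ xss n (F : ℕ → List ℕ → ℕ) → sumOver xss (λ xs → ∑ n (λ t → F t xs)) ≡ ∑ n (λ t → sumOver xss (F t))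
    sumOver-∑ xss zero    F = sumOver-zero xss
    sumOver-∑ xss (suc n) F = trans (sumOver-+ xss (F n) _) (cong (sumOver xss (F n) +_) (sumOver-∑ xss n F))

  sumOver-++ : ∀ xss yss F → sumOver (xss ++ yss) F ≡ sumOver xss F + sumOver yss F
  sumOver-++ xss yss F = trans (cong sum (map-++ F xss yss)) (sum-++ (map F xss) (map F yss))

  sumOver-map : ∀ (g : List ℕ → List ℕ) xss F → sumOver (map g xss) F ≡ sumOver xss (F ∘ g)
  sumOver-map g xss F = cong sum (sym (map-∘ xss))

  sumOver-concatMap : ∀ (g : List ℕ → List (List ℕ)) xss F → sumOver (concatMap g xss) F ≡ sumOver xss (λ xs → sumOver (g xs) F)
  sumOver-concatMap g []         F = refl
  sumOver-concatMap g (xs ∷ xss) F = trans (sumOver-++ (g xs) (concatMap g xss) F) (cong (sumOver (g xs) F +_) (sumOver-concatMap g xss F))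

  -- Gives the entries of `insAll x ys` an explicit insertion point `c`, so that a swap of positions
  -- can be compared with `c`. A point beyond the end appends.
  ins : ℕ → ℕ → List ℕ → List ℕ
  ins zero    x ys       = x ∷ ys
  ins (suc c) x []       = x ∷ []
  ins (suc c) x (y ∷ ys) = y ∷ ins c x ys

  opaque
    unfolding ∑

    ∑-head : ∀ n (f : ℕ → ℕ) → ∑ (suc n) f ≡ f 0 + ∑ n (f ∘ suc)
    ∑-head n f = trans (∑-split 1 n f) (cong (_+ ∑ n (f ∘ suc)) (+-identityʳ (f 0)))

    sumOver-insAll : ∀ x ys F → sumOver (insAll x ys) F ≡ ∑ (suc (length ys)) (λ c → F (ins c x ys))
    sumOver-insAll x []       F = refl
    sumOver-insAll x (y ∷ ys) F = trans
      (cong (F (x ∷ y ∷ ys) +_) (trans (sumOver-map (y ∷_) (insAll x ys) F) (sumOver-insAll x ys (F ∘ (y ∷_)))))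
      (sym (∑-head (suc (length ys)) (λ c → F (ins c x (y ∷ ys)))))

  insAll-length : ∀ x ys → All (λ zs → length zs ≡ suc (length ys)) (insAll x ys)
  insAll-length x []       = refl ∷ []
  insAll-length x (y ∷ ys) = refl ∷ All.map⁺ (All.map (cong suc) (insAll-length x ys))

  perms-length : ∀ xs → All (λ ys → length ys ≡ length xs) (perms xs)
  perms-length []       = refl ∷ []
  perms-length (x ∷ xs) = All.concat⁺ (All.map⁺ (All.map (λ {ys} e → All.map (λ q → trans q (cong suc e)) (insAll-length x ys)) (perms-length xs)))

  sumOver-perms-∷ : ∀ x xs F → sumOver (perms (x ∷ xs)) F ≡ ∑ (suc (length xs)) (λ c → sumOver (perms xs) (F ∘ ins c x))
  sumOver-perms-∷ x xs F = begin
    sumOver (concatMap (insAll x) (perms xs)) F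
      ≡⟨ sumOver-concatMap (insAll x) (perms xs) F ⟩
    sumOver (perms xs) (λ ys → sumOver (insAll x ys) F)
      ≡⟨ sumOver-cong (All.map (λ {ys} e → trans (sumOver-insAll x ys F) (cong (λ l → ∑ (suc l) (λ c → F (ins c x ys))) e)) (perms-length xs)) ⟩
    sumOver (perms xs) (λ ys → ∑ (suc (length xs)) (λ c → F (ins c x ys)))
      ≡⟨ sumOver-∑ (perms xs) (suc (length xs)) (λ c → F ∘ ins c x) ⟩
    ∑ (suc (length xs)) (λ c → sumOver (perms xs) (F ∘ ins c x)) ∎
    where open ≡-Reasoning

  swapAt : ℕ → List ℕ → List ℕ
  swapAt zero    (a ∷ b ∷ r) = b ∷ a ∷ r
  swapAt zero    r           = r
  swapAt (suc i) []          = []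
  swapAt (suc i) (a ∷ r)     = a ∷ swapAt i r

  nth-swapAt : ∀ i xs t → suc i < length xs → nth (swapAt i xs) t ≡ nth xs (tr i (suc i) t)
  nth-swapAt zero (a ∷ b ∷ r) zero          _ = refl
  nth-swapAt zero (a ∷ b ∷ r) (suc zero)    _ = refl
  nth-swapAt zero (a ∷ b ∷ r) (suc (suc t)) _ = sym (cong (nth (a ∷ b ∷ r)) (tr-o 0 1 (suc (suc t)) (λ ()) (λ ())))
  nth-swapAt (suc i) (a ∷ r) zero    _ = sym (cong (nth (a ∷ r)) (tr-o (suc i) (suc (suc i)) zero (λ ()) (λ ())))
  nth-swapAt (suc i) (a ∷ r) (suc t) (s≤s h) = trans (nth-swapAt i r t h) (cong (nth (a ∷ r)) (sym (tr-suc i (suc i) t)))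
  nth-swapAt (suc i) [] t ()
  nth-swapAt zero (a ∷ []) t (s≤s ())

  swapAt-ins-l : ∀ i x ys → i < length ys → swapAt i (ins i x ys) ≡ ins (suc i) x ys
  swapAt-ins-l zero    x (y ∷ ys) _       = refl
  swapAt-ins-l (suc i) x (y ∷ ys) (s≤s h) = cong (y ∷_) (swapAt-ins-l i x ys h)

  swapAt-ins-r : ∀ i x ys → i < length ys → swapAt i (ins (suc i) x ys) ≡ ins i x ys
  swapAt-ins-r zero    x (y ∷ ys) _       = refl
  swapAt-ins-r (suc i) x (y ∷ ys) (s≤s h) = cong (y ∷_) (swapAt-ins-r i x ys h)

  -- Both swapped cells lie before the inserted entry and keep their indices in `ys`; in
  -- `swapAt-ins-<` they lie behind it, and their indices in `ys` are one smaller.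
  swapAt-ins-> : ∀ i c x ys → suc i < c → c ≤ length ys → swapAt i (ins c x ys) ≡ ins c x (swapAt i ys)
  swapAt-ins-> zero    (suc zero)    x ys           (s≤s ()) _
  swapAt-ins-> zero    (suc (suc c)) x (y ∷ [])     _        (s≤s ())
  swapAt-ins-> zero    (suc (suc c)) x (y ∷ z ∷ ys) _        _       = refl
  swapAt-ins-> (suc i) (suc c)       x (y ∷ ys)     (s≤s h)  (s≤s l) = cong (y ∷_) (swapAt-ins-> i c x ys h l)

  swapAt-ins-< : ∀ i c x ys → c ≤ i → suc i < length ys → swapAt (suc i) (ins c x ys) ≡ ins c x (swapAt i ys)
  swapAt-ins-< i       zero    x ys           _       _       = refl
  swapAt-ins-< (suc i) (suc c) x (y ∷ ys)     (s≤s h) (s≤s l) = cong (y ∷_) (swapAt-ins-< i c x ys h l)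

  -- swapAt either exchanges two insertion points of x or acts on the list x is inserted into.
  sumOver-perms-swapAt : ∀ i xs F → suc i < length xs → sumOver (perms xs) (F ∘ swapAt i) ≡ sumOver (perms xs) F
  sumOver-perms-swapAt i (x ∷ xs) F (s≤s i<n) = begin
    sumOver (perms (x ∷ xs)) (F ∘ swapAt i)
      ≡⟨ sumOver-perms-∷ x xs (F ∘ swapAt i) ⟩
    ∑ (suc (length xs)) (λ c → sumOver (perms xs) (F ∘ swapAt i ∘ ins c x))
      ≡⟨ ∑-cong (suc (length xs)) (λ c c≤n → step i<n c (≤-pred c≤n)) ⟩
    ∑ (suc (length xs)) ((λ c → sumOver (perms xs) (F ∘ ins c x)) ∘ tr i (suc i))
      ≡⟨ ∑-tr (suc (length xs)) i (suc i) _ (m<n⇒m<1+n i<n) (s≤s i<n) ⟩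
    ∑ (suc (length xs)) (λ c → sumOver (perms xs) (F ∘ ins c x))
      ≡⟨ sym (sumOver-perms-∷ x xs F) ⟩
    sumOver (perms (x ∷ xs)) F ∎
    where
    open ≡-Reasoning
    congP : ∀ {f g : List ℕ → ℕ} → (∀ ys → length ys ≡ length xs → f ys ≡ g ys) → sumOver (perms xs) f ≡ sumOver (perms xs) g
    congP h = sumOver-cong (All.map (h _) (perms-length xs))
    step : ∀ {i} → i < length xs → ∀ c → c ≤ length xs → sumOver (perms xs) (F ∘ swapAt i ∘ ins c x) ≡ sumOver (perms xs) (F ∘ ins (tr i (suc i) c) x)
    step {i} i<n c c≤n with tr-cases i (suc i) c
    ... | inj₁ (refl , q) rewrite q = congP (λ ys e → cong F (swapAt-ins-l i x ys (subst (i <_) (sym e) i<n)))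
    ... | inj₂ (inj₁ (refl , q)) rewrite q = congP (λ ys e → cong F (swapAt-ins-r i x ys (subst (i <_) (sym e) i<n)))
    ... | inj₂ (inj₂ (a , b , q)) rewrite q with suc i <? c
    ...   | yes h = trans (congP (λ ys e → cong F (swapAt-ins-> i c x ys h (subst (c ≤_) (sym e) c≤n))))
                          (sumOver-perms-swapAt i xs (F ∘ ins c x) (<-≤-trans h c≤n))
    -- Here `c` is below `i`, because `c ≤ suc i` and both equalities are excluded. So the swapped
    -- cells lie behind the insertion point, and `i = 0` is contradictory.
    ...   | no h with i
    ...     | zero  = ⊥-elim (small c (≮⇒≥ h) a b)
      where
      small : ∀ c → c ≤ 1 → c ≢ 0 → c ≢ 1 → _
      small zero          _        p _ = p refl
      small (suc zero)    _        _ p = p refl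
      small (suc (suc c)) (s≤s ()) _ _
    ...     | suc i′ = trans (congP (λ ys e → cong F (swapAt-ins-< i′ c x ys (≤-pred (≤∧≢⇒< (≤-pred (≤∧≢⇒< (≮⇒≥ h) b)) a)) (subst (suc i′ <_) (sym e) i<n))))
                          (sumOver-perms-swapAt i′ xs (F ∘ ins c x) i<n)

  -- Ranks and groups in a random permutation

  insAll-All : ∀ {P : ℕ → Set} {x ys} → P x → All P ys → All (All P) (insAll x ys)
  insAll-All px []         = (px ∷ []) ∷ []
  insAll-All px (py ∷ pys) = (px ∷ py ∷ pys) ∷ All.map⁺ (All.map (py ∷_) (insAll-All px pys))

  perms-All : ∀ {P : ℕ → Set} {xs} → All P xs → All (All P) (perms xs)
  perms-All []         = [] ∷ []
  perms-All (px ∷ pxs) = All.concat⁺ (All.map⁺ (All.map (insAll-All px) (perms-All pxs)))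

  insAll-Unique : ∀ {x ys} → All (x ≢_) ys → Unique ys → All Unique (insAll x ys)
  insAll-Unique []         []       = ([] ∷ []) ∷ []
  insAll-Unique (p ∷ ps) (q ∷ qs) =
    ((p ∷ ps) ∷ q ∷ qs) ∷ All.map⁺ (All.map (λ (a , u) → a ∷ u) (All.zip (insAll-All (≢-sym p) q , insAll-Unique ps qs)))

  perms-Unique : ∀ {xs} → Unique xs → All Unique (perms xs)
  perms-Unique []       = [] ∷ []
  perms-Unique (p ∷ u) = All.concat⁺ (All.map⁺ (All.map (λ (a , v) → insAll-Unique a v) (All.zip (perms-All p , perms-Unique u))))

  All-nth : ∀ {P : ℕ → Set} {xs} → All P xs → ∀ t → t < length xs → P (nth xs t)
  All-nth (p ∷ ps) zero    _       = p
  All-nth (p ∷ ps) (suc t) (s≤s h) = All-nth ps t h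

  InjectiveBelow : ℕ → (ℕ → ℕ) → Set
  InjectiveBelow n B = ∀ u v → u < n → v < n → B u ≡ B v → u ≡ v

  nth-injective : ∀ {xs} → Unique xs → InjectiveBelow (length xs) (nth xs)
  nth-injective (p ∷ u) zero    zero    _       _       e = refl
  nth-injective (p ∷ u) zero    (suc t) _       (s≤s h) e = ⊥-elim (All-nth p t h e)
  nth-injective (p ∷ u) (suc s) zero    (s≤s h) _       e = ⊥-elim (All-nth p s h (sym e))
  nth-injective (p ∷ u) (suc s) (suc t) (s≤s g) (s≤s h) e = cong suc (nth-injective u s t g h e)

  opaque
    unfolding ∑

    ∑-mono-< : ∀ n {f g : ℕ → ℕ} u → (∀ t → t < n → f t ≤ g t) → u < n → f u < g u → ∑ n f < ∑ n g
    ∑-mono-< (suc n) u le u<1+n lt with u ≟ n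
    ... | yes refl = +-mono-<-≤ lt (∑-mono n (λ t h → le t (m≤n⇒m≤1+n h)))
    ... | no u≢n   = +-mono-≤-< (le n ≤-refl) (∑-mono-< n u (λ t h → le t (m≤n⇒m≤1+n h)) (≤∧≢⇒< (≤-pred u<1+n) u≢n) lt)

  -- Pigeonhole: a single term 0 would push a sum of `n` terms, each at most 1, strictly below `n`.
  ∑-ones : ∀ n (f : ℕ → ℕ) → (∀ t → t < n → f t ≤ 1) → n ≤ ∑ n f → ∀ r → r < n → f r ≡ 1
  ∑-ones n f le tot r r<n with f r in e | le r r<n
  ... | 1           | _      = refl
  ... | suc (suc _) | s≤s ()
  ... | 0           | _      = ⊥-elim (<⇒≱ (∑-mono-< n {f} {λ _ → 1} r le r<n (subst (_< 1) (sym e) (s≤s z≤n)))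
                                     (≤-trans (≤-reflexive (trans (∑-const n 1) (*-identityʳ n))) tot))

  opaque
    unfolding ∑

    ∑-fibre≤1 : ∀ n (f : ℕ → ℕ) r → InjectiveBelow n f → ∑ n (λ u → χ (f u ≡ᵇ r)) ≤ 1
    ∑-fibre≤1 zero    f r inj = z≤n
    ∑-fibre≤1 (suc n) f r inj with f n ≟ r
    ... | no ne rewrite ≡ᵇ-no ne = ∑-fibre≤1 n f r (λ u v p q → inj u v (m≤n⇒m≤1+n p) (m≤n⇒m≤1+n q))
    ... | yes e rewrite ≡ᵇ-yes e = s≤s (≤-reflexive (trans
      (∑-cong n (λ t t<n → ≡ᵇ-no (λ e′ → <⇒≢ t<n (inj t n (m≤n⇒m≤1+n t<n) ≤-refl (trans e′ (sym e))))))
      (∑-zero n)))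

  opaque
    unfolding ∑

    -- The map `b ↦ b ∸ χ (a <ᵇ b)` sends `0..K+1` onto `0..K` and takes the value `a` twice, at
    -- `b = a` and at `b = a + 1`. The extra `ψ a` is the source of the diagonal term in the joint
    -- law of two groups.
    ∑-skip : ∀ a K (ψ : ℕ → ℕ) → a ≤ K → ∑ (suc (suc K)) (λ b → ψ (b ∸ χ (a <ᵇ b))) ≡ ∑ (suc K) ψ + ψ a
    ∑-skip a K ψ a≤K rewrite <ᵇ-yes (s≤s a≤K) with a ≟ K
    ... | yes refl = trans (cong (ψ a +_) (∑-cong (suc a) (λ b h → cong (λ c → ψ (b ∸ c)) (<ᵇ-no {a} {b} (≤-pred h)))))
                           (+-comm (ψ a) _)
    ∑-skip a zero    ψ a≤K | no a≢K = ⊥-elim (a≢K (n≤0⇒n≡0 a≤K))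
    ∑-skip a (suc K) ψ a≤K | no a≢K = trans (cong (ψ (suc K) +_) (∑-skip a K ψ (≤-pred (≤∧≢⇒< a≤K a≢K))))
                                            (sym (+-assoc (ψ (suc K)) _ (ψ a)))

    ∑-χ< : ∀ q l → l ≤ q → ∑ q (λ r → χ (r <ᵇ l)) ≡ l
    ∑-χ< zero    zero _ = refl
    ∑-χ< (suc q) l l≤q with l ≟ suc q
    ... | yes refl rewrite <ᵇ-yes {q} ≤-refl = cong suc (trans (∑-cong q (λ r r<q → <ᵇ-yes (m<n⇒m<1+n r<q))) (trans (∑-const q 1) (*-identityʳ q)))
    ... | no ne rewrite <ᵇ-no (≤-pred (≤∧≢⇒< l≤q ne)) = ∑-χ< q l (≤-pred (≤∧≢⇒< l≤q ne))

  opaque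
    unfolding ∑

    rank : (ℕ → ℕ) → ℕ → ℕ → ℕ
    rank B q x = ∑ q (λ t → χ (B t <ᵇ x))

    χ-<ᵇ-mono : ∀ a {x y} → x ≤ y → χ (a <ᵇ x) ≤ χ (a <ᵇ y)
    χ-<ᵇ-mono a {x} {y} x≤y with a <? x
    ... | yes h rewrite <ᵇ-yes h | <ᵇ-yes (<-≤-trans h x≤y) = ≤-refl
    ... | no h  rewrite <ᵇ-no (≮⇒≥ h) = z≤n

    rank-mono : ∀ B q {x y} → x ≤ y → rank B q x ≤ rank B q y
    rank-mono B q x≤y = ∑-mono q (λ t _ → χ-<ᵇ-mono (B t) x≤y)

    rank-mono-< : ∀ B q {u y} → u < q → B u < y → rank B q (B u) < rank B q y
    rank-mono-< B q {u} {y} u<q lt = ∑-mono-< q u (λ t _ → χ-<ᵇ-mono (B t) (<⇒≤ lt)) u<q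
      (subst₂ _<_ (sym (<ᵇ-no {B u} ≤-refl)) (sym (<ᵇ-yes lt)) ≤-refl)

    rank≤ : ∀ B q x → rank B q x ≤ q
    rank≤ B q x = ≤-trans (∑-mono q (λ t _ → χ≤1 (B t <ᵇ x))) (≤-reflexive (trans (∑-const q 1) (*-identityʳ q)))

    rank-self : ∀ B p → rank B (suc p) (B p) ≡ rank B p (B p)
    rank-self B p rewrite <ᵇ-no {B p} ≤-refl = refl

    rank< : ∀ B q u → u < q → rank B q (B u) < q
    rank< B q u u<q = <-≤-trans
      (∑-mono-< q {g = λ _ → 1} u (λ t _ → χ≤1 (B t <ᵇ B u)) u<q (subst (_< 1) (sym (<ᵇ-no {B u} ≤-refl)) ≤-refl))
      (≤-reflexive (trans (∑-const q 1) (*-identityʳ q)))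

    rank-injective : ∀ B q → InjectiveBelow q B → InjectiveBelow q (λ u → rank B q (B u))
    rank-injective B q inj u v u<q v<q e with <-cmp (B u) (B v)
    ... | tri< lt _ _ = ⊥-elim (<⇒≢ (rank-mono-< B q u<q lt) e)
    ... | tri≈ _ eq _ = inj u v u<q v<q eq
    ... | tri> _ _ gt = ⊥-elim (>⇒≢ (rank-mono-< B q v<q gt) e)

    -- Double counting: each of the `q` entries has one rank below `q`, so the fibre sizes add up to
    -- `q`; by injectivity each fibre has at most one element, so all have exactly one.
    rank-bijective : ∀ B q r → InjectiveBelow q B → r < q → ∑ q (λ u → χ (rank B q (B u) ≡ᵇ r)) ≡ 1
    rank-bijective B q r inj = ∑-ones q (λ r → ∑ q (λ u → χ (rank B q (B u) ≡ᵇ r)))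
      (λ r _ → ∑-fibre≤1 q (λ u → rank B q (B u)) r (rank-injective B q inj))
      (≤-reflexive (sym (begin
        ∑ q (λ r → ∑ q (λ u → χ (rank B q (B u) ≡ᵇ r)))
          ≡⟨ ∑-comm q q _ ⟩
        ∑ q (λ u → ∑ q (λ r → χ (rank B q (B u) ≡ᵇ r)))
          ≡⟨ ∑-cong q (λ u u<q → trans (∑-cong q (λ r _ → sym (*-identityʳ _)))
                                       (∑-δ q (rank B q (B u)) (λ _ → 1) (rank< B q u u<q))) ⟩
        ∑ q (λ _ → 1)
          ≡⟨ trans (∑-const q 1) (*-identityʳ q) ⟩
        q ∎)))
      r
      where open ≡-Reasoning

    rank-ext : ∀ {B C : ℕ → ℕ} q s → (∀ t → B t ≡ C t) → rank B q (B s) ≡ rank C q (C s)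
    rank-ext q s e = ∑-cong q (λ t _ → cong₂ (λ a b → χ (a <ᵇ b)) (e t) (e s))

    rank-tr : ∀ B q x {u v} → u < q → v < q → rank (B ∘ tr u v) q x ≡ rank B q x
    rank-tr B q x {u} {v} u<q v<q = ∑-tr q u v (λ t → χ (B t <ᵇ x)) u<q v<q

    -- Dropping entry `k` from the comparison lowers the rank of entry `k + 1` exactly when
    -- `B k < B (suc k)`, and this can be read off the two ranks alone. So the group of the second
    -- non-pivot is a function of the two independent ranks.
    rank-skip : ∀ B k → rank B k (B (suc k)) ≡ rank B (suc k) (B (suc k)) ∸ χ (rank B k (B k) <ᵇ rank B (suc k) (B (suc k)))
    rank-skip B k with B k <? B (suc k)
    ... | yes lt rewrite <ᵇ-yes lt | <ᵇ-yes (s≤s (rank-mono B k (<⇒≤ lt))) = refl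
    ... | no nlt rewrite <ᵇ-no (≮⇒≥ nlt) | <ᵇ-no (rank-mono B k (≮⇒≥ nlt)) = refl

  -- A swapped list and `B ∘ tr u v` agree only pointwise as arrays, so a functional must respect
  -- pointwise equality before a swap can be carried out in its argument.
  Extensional : ((ℕ → ℕ) → ℕ) → Set
  Extensional F = ∀ {B C} → (∀ t → B t ≡ C t) → F B ≡ F C

  -- #perms n = n!, and S n F / #perms n is the expectation of F over random permutations, indexed from 0.
  opaque
    S : ℕ → ((ℕ → ℕ) → ℕ) → ℕ
    S n F = sumOver (allPerms n) (F ∘ nth)

    #perms : ℕ → ℕ
    #perms n = length (allPerms n)

    length-range : ∀ n → length (map suc (upTo n)) ≡ n
    length-range n = trans (length-map suc (upTo n)) (length-upTo n)

    allPerms-injective : ∀ n → All (λ xs → InjectiveBelow n (nth xs)) (allPerms n)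
    allPerms-injective n = All.map (λ {xs} (l , u) → subst (λ l → InjectiveBelow l (nth xs)) (trans l (length-range n)) (nth-injective u))
      (All.zip (perms-length (map suc (upTo n)) , perms-Unique (Unique.map⁺ suc-injective (Unique.upTo⁺ n))))

    S-cong : ∀ n {F H} → (∀ B → InjectiveBelow n B → F B ≡ H B) → S n F ≡ S n H
    S-cong n e = sumOver-cong (All.map (e _) (allPerms-injective n))

    S-cong′ : ∀ n {F H} → (∀ B → F B ≡ H B) → S n F ≡ S n H
    S-cong′ n e = S-cong n (λ B _ → e B)

    S-*ʳ : ∀ n c F → S n (λ B → F B * c) ≡ S n F * c
    S-*ʳ n c F = sumOver-*ʳ (allPerms n) c (F ∘ nth)

    S-∑ : ∀ n q (F : ℕ → (ℕ → ℕ) → ℕ) → S n (λ B → ∑ q (λ t → F t B)) ≡ ∑ q (λ t → S n (F t))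
    S-∑ n q F = sumOver-∑ (allPerms n) q (λ t → F t ∘ nth)

    S-const : ∀ n c → S n (λ _ → c) ≡ #perms n * c
    S-const n c = begin
      S n (λ _ → c)         ≡⟨ S-cong′ n (λ _ → sym (*-identityˡ c)) ⟩
      S n (λ _ → 1 * c)     ≡⟨ S-*ʳ n c (λ _ → 1) ⟩
      S n (λ _ → 1) * c     ≡⟨ cong (_* c) (sumOver-1 (allPerms n)) ⟩
      #perms n * c              ∎
      where open ≡-Reasoning

    S-adjacent : ∀ n i {F} → suc i < n → Extensional F → S n (λ B → F (B ∘ tr i (suc i))) ≡ S n F
    S-adjacent n i {F} i<n ext = trans
      (sumOver-cong (All.map (λ {xs} l → ext (λ t → sym (nth-swapAt i xs t (subst (suc i <_) (sym (trans l (length-range n))) i<n))))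
        (perms-length (map suc (upTo n)))))
      (sumOver-perms-swapAt i (map suc (upTo n)) (F ∘ nth) (subst (suc i <_) (sym (length-range n)) i<n))

  S-tr-< : ∀ n u v {F} → u < v → v < n → Extensional F → S n (λ B → F (B ∘ tr u v)) ≡ S n F
  S-tr-< n u (suc v) {F} u<1+v v<n ext with u ≟ v
  ... | yes refl = S-adjacent n u v<n ext
  ... | no u≢v = begin
    S n (λ B → F (B ∘ tr u (suc v)))
      ≡⟨ S-cong′ n (λ B → ext (λ t → cong B (sym (tr-conj u v t u<v)))) ⟩
    S n (λ B → F (B ∘ tr v (suc v) ∘ tr u v ∘ tr v (suc v)))
      ≡⟨ S-adjacent n v {λ B → F (B ∘ tr u v ∘ tr v (suc v))} v<n (λ e → ext (λ t → e _)) ⟩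
    S n (λ B → F (B ∘ tr u v ∘ tr v (suc v)))
      ≡⟨ S-tr-< n u v {λ B → F (B ∘ tr v (suc v))} u<v (<-trans ≤-refl v<n) (λ e → ext (λ t → e _)) ⟩
    S n (λ B → F (B ∘ tr v (suc v)))
      ≡⟨ S-adjacent n v v<n ext ⟩
    S n F ∎
    where
    open ≡-Reasoning
    u<v = ≤∧≢⇒< (≤-pred u<1+v) u≢v

  S-tr : ∀ n u v {F} → u < n → v < n → Extensional F → S n (λ B → F (B ∘ tr u v)) ≡ S n F
  S-tr n u v u<n v<n ext with <-cmp u v
  ... | tri< lt _ _   = S-tr-< n u v lt v<n ext
  ... | tri≈ _ refl _ = S-cong′ n (λ B → ext (λ t → cong B (tr-id u t)))
  ... | tri> _ _ gt   = trans (S-cong′ n (λ B → ext (λ t → cong B (tr-sym u v t)))) (S-tr-< n v u gt u<n ext)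

  -- Swapping p with each u ≤ p averages the indicator over all u, and exactly one u has rank r.
  rank-uniform : ∀ n p r F → p < n → r ≤ p → Extensional F →
    (∀ u B → u < p → F (B ∘ tr u p) ≡ F B) →
    suc p * S n (λ B → χ (rank B p (B p) ≡ᵇ r) * F B) ≡ S n F
  rank-uniform n p r F p<n r≤p ext sm = begin
    suc p * S n (λ B → χ (rank B p (B p) ≡ᵇ r) * F B)
      ≡⟨ sym (∑-const (suc p) _) ⟩
    ∑ (suc p) (λ u → S n (λ B → χ (rank B p (B p) ≡ᵇ r) * F B))
      ≡⟨ ∑-cong (suc p) (λ u h → move u (≤-pred h)) ⟩
    ∑ (suc p) (λ u → S n (λ B → χ (rank B (suc p) (B u) ≡ᵇ r) * F B))
      ≡⟨ sym (S-∑ n (suc p) (λ u B → χ (rank B (suc p) (B u) ≡ᵇ r) * F B)) ⟩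
    S n (λ B → ∑ (suc p) (λ u → χ (rank B (suc p) (B u) ≡ᵇ r) * F B))
      ≡⟨ S-cong n (λ B inj → trans (∑-*ʳ (suc p) (F B) _)
           (trans (cong (_* F B) (rank-bijective B (suc p) r
                     (λ u v hu hv → inj u v (<-≤-trans hu p<n) (<-≤-trans hv p<n)) (s≤s r≤p)))
                  (*-identityˡ (F B)))) ⟩
    S n F ∎
    where
    open ≡-Reasoning
    sym′ : ∀ u B → u ≤ p → F (B ∘ tr u p) ≡ F B
    sym′ u B u≤p with u ≟ p
    ... | yes refl = ext (λ t → cong B (tr-id u t))
    ... | no ne    = sm u B (≤∧≢⇒< u≤p ne)
    H : (ℕ → ℕ) → ℕ
    H B = χ (rank B p (B p) ≡ᵇ r) * F B
    -- Counting entry `p` among the first `p + 1` adds nothing to its own rank, and in that form the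
    -- set of compared positions is invariant under the swap of `u` and `p`.
    move : ∀ u → u ≤ p → S n H ≡ S n (λ B → χ (rank B (suc p) (B u) ≡ᵇ r) * F B)
    move u u≤p = trans (sym (S-tr n u p {H} (≤-<-trans u≤p p<n) p<n
        (λ e → cong₂ (λ a b → χ (a ≡ᵇ r) * b) (rank-ext p p e) (ext e))))
      (S-cong′ n (λ B → cong₂ (λ a b → χ (a ≡ᵇ r) * b)
        (trans (sym (rank-self (B ∘ tr u p) p))
          (trans (rank-tr B (suc p) (B (tr u p p)) (s≤s u≤p) ≤-refl)
                 (cong (λ x → rank B (suc p) (B x)) (tr-r u p))))
        (sym′ u B u≤p)))

  -- Groups of the non-pivots: joint law, full sums and sums over the first ℓ of them

  module Groups (k N′ : ℕ) where

    -- At least two non-pivots, so that the offsets 0 and 1 used in the two-element law exist;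
    -- smaller inputs fall below the threshold of `LinPlusO1`.
    N n : ℕ
    N = suc (suc N′)
    n = k + N

    G : (ℕ → ℕ) → ℕ → ℕ
    G B s = rank B k (B (k + s))

    G≤k : ∀ B s → G B s < suc k
    G≤k B s = s≤s (rank≤ B k _)

    k<n : k < n
    k<n = subst (k <_) (sym (+-suc k (suc N′))) (s≤s (m≤m+n k (suc N′)))

    k+<n : ∀ {s} → s < N → k + s < n
    k+<n = +-monoʳ-< k

    G-ext : ∀ {B C : ℕ → ℕ} s → (∀ t → B t ≡ C t) → G B s ≡ G C s
    G-ext s = rank-ext k (k + s)

    opaque
      unfolding rank

      G-tr : ∀ B s s′ t → G (B ∘ tr (k + s) (k + s′)) t ≡ G B (tr s s′ t)
      G-tr B s s′ t = ∑-cong k (λ r r<k → cong₂ (λ a b → χ (B a <ᵇ B b))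
        (tr-o (k + s) (k + s′) r (<⇒≢ (<-≤-trans r<k (m≤m+n k s))) (<⇒≢ (<-≤-trans r<k (m≤m+n k s′))))
        (tr-shift k s s′ t))

    -- The group of the first non-pivot is its rank among its `k` predecessors, hence uniform on
    -- `k + 1` values.
    E-one : (f : ℕ → ℕ) → suc k * S n (λ B → f (G B 0)) ≡ #perms n * ∑ (suc k) f
    E-one f = begin
      suc k * S n (λ B → f (G B 0))
        ≡⟨ cong (suc k *_) (S-cong′ n (λ B → sym (∑-δ (suc k) (G B 0) f (G≤k B 0)))) ⟩
      suc k * S n (λ B → ∑ (suc k) (λ a → χ (G B 0 ≡ᵇ a) * f a))
        ≡⟨ cong (suc k *_) (S-∑ n (suc k) (λ a B → χ (G B 0 ≡ᵇ a) * f a)) ⟩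
      suc k * ∑ (suc k) (λ a → S n (λ B → χ (G B 0 ≡ᵇ a) * f a))
        ≡⟨ sym (∑-*ˡ (suc k) (suc k) _) ⟩
      ∑ (suc k) (λ a → suc k * S n (λ B → χ (G B 0 ≡ᵇ a) * f a))
        ≡⟨ ∑-cong (suc k) (λ a h → trans
             (cong (λ j → suc k * S n (λ B → χ (rank B k (B j) ≡ᵇ a) * f a)) (+-identityʳ k))
             (trans (rank-uniform n k a (λ _ → f a) k<n (≤-pred h) (λ _ → refl) (λ _ _ _ → refl))
                    (S-const n (f a)))) ⟩
      ∑ (suc k) (λ a → #perms n * f a)
        ≡⟨ ∑-*ˡ (suc k) (#perms n) f ⟩
      #perms n * ∑ (suc k) f ∎
      where open ≡-Reasoning

    -- Among the first k + 2 positions, the relative ranks of the last two are independent and uniform.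
    E-two : (φ ψ : ℕ → ℕ) → suc k * (suc (suc k) * S n (λ B → φ (G B 0) * ψ (G B 1)))
         ≡ #perms n * (∑ (suc k) φ * ∑ (suc k) ψ + ∑ (suc k) (λ a → φ a * ψ a))
    E-two φ ψ = begin
      suc k * (suc (suc k) * S n (λ B → φ (G B 0) * ψ (G B 1)))
        ≡⟨ cong (λ s → suc k * (suc (suc k) * s)) (S-cong′ n (λ B → trans (to-h B) (expand (R₁ B) (R₂ B) (s≤s (rank≤ B k _)) (s≤s (rank≤ B (suc k) _))))) ⟩
      suc k * (suc (suc k) * S n (λ B → ∑ (suc k) (λ a → ∑ (suc (suc k)) (λ b → Q a b B))))
        ≡⟨ cong (λ s → suc k * (suc (suc k) * s)) (trans (S-∑ n (suc k) (λ a B → ∑ (suc (suc k)) (λ b → Q a b B)))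
             (∑-cong (suc k) (λ a _ → S-∑ n (suc (suc k)) (Q a)))) ⟩
      suc k * (suc (suc k) * ∑ (suc k) (λ a → ∑ (suc (suc k)) (λ b → S n (Q a b))))
        ≡⟨ cong (suc k *_) (sym (∑-*ˡ (suc k) (suc (suc k)) _)) ⟩
      suc k * ∑ (suc k) (λ a → suc (suc k) * ∑ (suc (suc k)) (λ b → S n (Q a b)))
        ≡⟨ sym (∑-*ˡ (suc k) (suc k) _) ⟩
      ∑ (suc k) (λ a → suc k * (suc (suc k) * ∑ (suc (suc k)) (λ b → S n (Q a b))))
        ≡⟨ ∑-cong (suc k) (λ a a≤k → trans (sym (*-assoc (suc k) (suc (suc k)) (∑ (suc (suc k)) (λ b → S n (Q a b)))))
              (trans (sym (∑-*ˡ (suc (suc k)) (suc k * suc (suc k)) (λ b → S n (Q a b))))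
                (∑-cong (suc (suc k)) (λ b b≤k → trans (lem (suc k) (suc (suc k)) (S n (Q a b))) (evalQ a b (≤-pred a≤k) (≤-pred b≤k)))))) ⟩
      ∑ (suc k) (λ a → ∑ (suc (suc k)) (λ b → #perms n * h a b))
        ≡⟨ ∑-cong (suc k) (λ a _ → ∑-*ˡ (suc (suc k)) (#perms n) (h a)) ⟩
      ∑ (suc k) (λ a → #perms n * ∑ (suc (suc k)) (h a))
        ≡⟨ ∑-*ˡ (suc k) (#perms n) _ ⟩
      #perms n * ∑ (suc k) (λ a → ∑ (suc (suc k)) (h a))
        ≡⟨ cong (#perms n *_) (∑-cong (suc k) (λ a a≤k → trans (∑-*ˡ (suc (suc k)) (φ a) _)
             (trans (cong (φ a *_) (∑-skip a k ψ (≤-pred a≤k))) (*-distribˡ-+ (φ a) _ (ψ a))))) ⟩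
      #perms n * ∑ (suc k) (λ a → φ a * ∑ (suc k) ψ + φ a * ψ a)
        ≡⟨ cong (#perms n *_) (trans (∑-+ (suc k) _ _) (cong (_+ ∑ (suc k) (λ a → φ a * ψ a)) (∑-*ʳ (suc k) (∑ (suc k) ψ) φ))) ⟩
      #perms n * (∑ (suc k) φ * ∑ (suc k) ψ + ∑ (suc k) (λ a → φ a * ψ a)) ∎
      where
      open ≡-Reasoning
      R₁ R₂ : (ℕ → ℕ) → ℕ
      R₁ B = rank B k (B k)
      R₂ B = rank B (suc k) (B (suc k))
      h : ℕ → ℕ → ℕ
      h a b = φ a * ψ (b ∸ χ (a <ᵇ b))
      Q : ℕ → ℕ → (ℕ → ℕ) → ℕ
      Q a b B = χ (R₁ B ≡ᵇ a) * (χ (R₂ B ≡ᵇ b) * h a b)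
      to-h : ∀ B → φ (G B 0) * ψ (G B 1) ≡ h (R₁ B) (R₂ B)
      to-h B = cong₂ (λ a b → φ a * ψ b)
        (cong (λ j → rank B k (B j)) (+-identityʳ k))
        (trans (cong (λ j → rank B k (B j)) (+-comm k 1)) (rank-skip B k))
      expand : ∀ r s → r < suc k → s < suc (suc k) →
        h r s ≡ ∑ (suc k) (λ a → ∑ (suc (suc k)) (λ b → χ (r ≡ᵇ a) * (χ (s ≡ᵇ b) * h a b)))
      expand r s r< s< = trans (sym (∑-δ (suc k) r (λ a → h a s) r<))
        (∑-cong (suc k) (λ a _ → trans (cong (χ (r ≡ᵇ a) *_) (sym (∑-δ (suc (suc k)) s (h a) s<)))
          (sym (∑-*ˡ (suc (suc k)) (χ (r ≡ᵇ a)) _))))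
      lem : ∀ a b c → a * b * c ≡ b * (a * c)
      lem = solve-∀
      1+k<n : suc k < n
      1+k<n = subst (_< n) (+-comm k 1) (k+<n (s≤s (s≤s z≤n)))
      -- Independence of the two ranks: `R₂` is invariant under swaps within the first `k + 1`
      -- entries, so `R₁` is uniform even with the event `R₂ = b` as a factor; then `R₂` is averaged
      -- by itself.
      evalQ : ∀ a b → a ≤ k → b ≤ suc k → suc (suc k) * (suc k * S n (Q a b)) ≡ #perms n * h a b
      evalQ a b a≤k b≤k = trans
        (cong (suc (suc k) *_) (rank-uniform n k a (λ B → χ (R₂ B ≡ᵇ b) * h a b) k<n a≤k
          (λ e → cong (λ r → χ (r ≡ᵇ b) * h a b) (rank-ext (suc k) (suc k) e))
          (λ u B u<k → cong (λ r → χ (r ≡ᵇ b) * h a b)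
            (trans (rank-tr B (suc k) _ (m<n⇒m<1+n u<k) ≤-refl)
                   (cong (λ j → rank B (suc k) (B j)) (tr-o u k (suc k) (>⇒≢ (m<n⇒m<1+n u<k)) (>⇒≢ ≤-refl)))))))
        (trans (rank-uniform n (suc k) b (λ _ → h a b) 1+k<n b≤k (λ _ → refl) (λ _ _ _ → refl)) (S-const n (h a b)))

    S-one : ∀ f s → s < N → S n (λ B → f (G B s)) ≡ S n (λ B → f (G B 0))
    S-one f s s<N = trans
      (S-cong′ n (λ B → cong f (sym (trans (G-tr B 0 s 0) (cong (G B) (tr-l 0 s))))))
      (S-tr n (k + 0) (k + s) {λ B → f (G B 0)} (k+<n (s≤s z≤n)) (k+<n s<N) (λ e → cong f (G-ext 0 e)))

    S-two : ∀ (φ ψ : ℕ → ℕ) s t → s < N → t < N → s ≢ t → S n (λ B → φ (G B s) * ψ (G B t)) ≡ S n (λ B → φ (G B 0) * ψ (G B 1))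
    S-two φ ψ s t s<N t<N s≢t = begin
      S n (λ B → φ (G B s) * ψ (G B t))
        ≡⟨ S-cong′ n (λ B → cong₂ (λ a b → φ a * ψ b)
             (sym (trans (G-tr B 0 s 0) (cong (G B) (tr-l 0 s))))
             (sym (trans (G-tr B 0 s t′) (cong (G B) tr-t′)))) ⟩
      S n (λ B → φ (G (B ∘ tr (k + 0) (k + s)) 0) * ψ (G (B ∘ tr (k + 0) (k + s)) t′))
        ≡⟨ S-tr n (k + 0) (k + s) {λ B → φ (G B 0) * ψ (G B t′)} (k+<n (s≤s z≤n)) (k+<n s<N)
             (λ e → cong₂ (λ a b → φ a * ψ b) (G-ext 0 e) (G-ext t′ e)) ⟩
      S n (λ B → φ (G B 0) * ψ (G B t′))
        ≡⟨ S-cong′ n (λ B → cong₂ (λ a b → φ a * ψ b)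
             (sym (trans (G-tr B 1 t′ 0) (cong (G B) (tr-o 1 t′ 0 (λ ()) (≢-sym t′≢0)))))
             (sym (trans (G-tr B 1 t′ 1) (cong (G B) (tr-l 1 t′))))) ⟩
      S n (λ B → φ (G (B ∘ tr (k + 1) (k + t′)) 0) * ψ (G (B ∘ tr (k + 1) (k + t′)) 1))
        ≡⟨ S-tr n (k + 1) (k + t′) {λ B → φ (G B 0) * ψ (G B 1)} (k+<n (s≤s (s≤s z≤n))) (k+<n t′<N)
             (λ e → cong₂ (λ a b → φ a * ψ b) (G-ext 0 e) (G-ext 1 e)) ⟩
      S n (λ B → φ (G B 0) * ψ (G B 1)) ∎
      where
      open ≡-Reasoning
      -- The swap that brings `s` to 0 may displace `t`: if `t = 0`, its element now sits at `s`.
      -- The second swap must start from this new place.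
      t′ : ℕ
      t′ = tr 0 s t
      tr-t′ : tr 0 s t′ ≡ t
      tr-t′ with tr-cases 0 s t
      ... | inj₁ (e , q)               = trans (cong (tr 0 s) q) (trans (tr-r 0 s) (sym e))
      ... | inj₂ (inj₁ (e , q))        = ⊥-elim (s≢t (sym e))
      ... | inj₂ (inj₂ (a , b , q)) = trans (cong (tr 0 s) q) q
      t′≢0 : t′ ≢ 0
      t′≢0 with tr-cases 0 s t
      ... | inj₁ (e , q)               = λ z → s≢t (trans (trans (sym q) z) (sym e))
      ... | inj₂ (inj₁ (e , q))        = ⊥-elim (s≢t (sym e))
      ... | inj₂ (inj₂ (a , b , q)) = λ z → a (trans (sym q) z)
      t′<N : t′ < N
      t′<N with tr-cases 0 s t
      ... | inj₁ (e , q)               = subst (_< N) (sym q) s<N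
      ... | inj₂ (inj₁ (e , q))        = ⊥-elim (s≢t (sym e))
      ... | inj₂ (inj₂ (a , b , q)) = subst (_< N) (sym q) t<N

    Full : (ℕ → ℕ) → (ℕ → ℕ) → ℕ
    Full f B = ∑ N (λ s → f (G B s))

    E-Full : ∀ f → suc k * S n (Full f) ≡ N * (#perms n * ∑ (suc k) f)
    E-Full f = begin
      suc k * S n (Full f)
        ≡⟨ cong (suc k *_) (trans (S-∑ n N (λ s B → f (G B s))) (trans (∑-cong N (λ s s<N → S-one f s s<N)) (∑-const N _))) ⟩
      suc k * (N * S n (λ B → f (G B 0)))
        ≡⟨ lem (suc k) N (S n (λ B → f (G B 0))) ⟩
      N * (suc k * S n (λ B → f (G B 0)))
        ≡⟨ cong (N *_) (E-one f) ⟩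
      N * (#perms n * ∑ (suc k) f) ∎
      where
      open ≡-Reasoning
      lem : ∀ a b c → a * (b * c) ≡ b * (a * c)
      lem = solve-∀

    module Head (φ : ℕ → ℕ) (φ≤1 : ∀ a → φ a ≤ 1) where

      ℓ : (ℕ → ℕ) → ℕ
      ℓ = Full φ

      -- The sum over the first `ℓ B` non-pivots. The indicator keeps the range independent of `B`,
      -- so that summation over permutations and over positions can be exchanged.
      Head : (ℕ → ℕ) → (ℕ → ℕ) → ℕ
      Head f B = ∑ N (λ r → χ (r <ᵇ ℓ B) * f (G B r))

      ℓ≤N : ∀ B → ℓ B ≤ N
      ℓ≤N B = ≤-trans (∑-mono N (λ t _ → φ≤1 (G B t))) (≤-reflexive (trans (∑-const N 1) (*-identityʳ N)))

      ℓ-tr : ∀ B s s′ → s < N → s′ < N → ℓ (B ∘ tr (k + s) (k + s′)) ≡ ℓ B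
      ℓ-tr B s s′ s<N s′<N = trans (∑-cong N (λ t _ → cong φ (G-tr B s s′ t))) (∑-tr N s s′ (λ t → φ (G B t)) s<N s′<N)

      ℓ-ext : Extensional ℓ
      ℓ-ext e = ∑-cong N (λ t _ → cong φ (G-ext t e))

      -- ℓ is symmetric in the non-pivot positions, so f (G r) may be replaced by its average over them.
      S-Head : ∀ f → N * S n (Head f) ≡ S n (λ B → ℓ B * Full f B)
      S-Head f = begin
        N * S n (Head f)
          ≡⟨ cong (N *_) (S-∑ n N (λ r B → χ (r <ᵇ ℓ B) * f (G B r))) ⟩
        N * ∑ N (λ r → S n (λ B → χ (r <ᵇ ℓ B) * f (G B r)))
          ≡⟨ sym (∑-*ˡ N N _) ⟩
        ∑ N (λ r → N * S n (λ B → χ (r <ᵇ ℓ B) * f (G B r)))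
          ≡⟨ ∑-cong N (λ r r<N → trans (sym (∑-const N _)) (∑-cong N (λ s s<N → move r s r<N s<N))) ⟩
        ∑ N (λ r → ∑ N (λ s → S n (λ B → χ (r <ᵇ ℓ B) * f (G B s))))
          ≡⟨ ∑-cong N (λ r _ → sym (S-∑ n N (λ s B → χ (r <ᵇ ℓ B) * f (G B s)))) ⟩
        ∑ N (λ r → S n (λ B → ∑ N (λ s → χ (r <ᵇ ℓ B) * f (G B s))))
          ≡⟨ ∑-cong N (λ r _ → S-cong′ n (λ B → ∑-*ˡ N (χ (r <ᵇ ℓ B)) _)) ⟩
        ∑ N (λ r → S n (λ B → χ (r <ᵇ ℓ B) * Full f B))
          ≡⟨ sym (S-∑ n N (λ r B → χ (r <ᵇ ℓ B) * Full f B)) ⟩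
        S n (λ B → ∑ N (λ r → χ (r <ᵇ ℓ B) * Full f B))
          ≡⟨ S-cong′ n (λ B → trans (∑-*ʳ N (Full f B) _) (cong (_* Full f B) (∑-χ< N (ℓ B) (ℓ≤N B)))) ⟩
        S n (λ B → ℓ B * Full f B) ∎
        where
        open ≡-Reasoning
        move : ∀ r s → r < N → s < N → S n (λ B → χ (r <ᵇ ℓ B) * f (G B r)) ≡ S n (λ B → χ (r <ᵇ ℓ B) * f (G B s))
        move r s r<N s<N = sym (trans
          (S-cong′ n (λ B → cong₂ (λ l g → χ (r <ᵇ l) * f g) (sym (ℓ-tr B r s r<N s<N))
            (sym (trans (G-tr B r s r) (cong (G B) (tr-l r s))))))
          (S-tr n (k + r) (k + s) {λ B → χ (r <ᵇ ℓ B) * f (G B r)} (k+<n r<N) (k+<n s<N)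
            (λ e → cong₂ (λ l g → χ (r <ᵇ l) * f g) (ℓ-ext e) (G-ext r e))))

      -- Expanding the product gives `N` diagonal pairs and `N (N - 1)` ordered pairs of distinct
      -- positions, where `N - 1` is `suc N′`; all pairs of one kind contribute equally by symmetry.
      S-product : ∀ f → S n (λ B → ℓ B * Full f B)
        ≡ N * (S n (λ B → φ (G B 0) * f (G B 0)) + suc N′ * S n (λ B → φ (G B 0) * f (G B 1)))
      S-product f = begin
        S n (λ B → ℓ B * Full f B)
          ≡⟨ S-cong′ n (λ B → trans (sym (∑-*ʳ N (Full f B) _)) (∑-cong N (λ s _ → sym (∑-*ˡ N (φ (G B s)) _)))) ⟩
        S n (λ B → ∑ N (λ s → ∑ N (λ t → φ (G B s) * f (G B t))))
          ≡⟨ trans (S-∑ n N (λ s B → ∑ N (λ t → φ (G B s) * f (G B t))))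
                   (∑-cong N (λ s _ → S-∑ n N (λ t B → φ (G B s) * f (G B t)))) ⟩
        ∑ N (λ s → ∑ N (λ t → S n (λ B → φ (G B s) * f (G B t))))
          ≡⟨ ∑-cong N (λ s s<N → row s s<N) ⟩
        ∑ N (λ s → d + suc N′ * c)
          ≡⟨ ∑-const N _ ⟩
        N * (d + suc N′ * c) ∎
        where
        open ≡-Reasoning
        c d : ℕ
        c = S n (λ B → φ (G B 0) * f (G B 1))
        d = S n (λ B → φ (G B 0) * f (G B 0))
        lem : ∀ d c x → d + (c + x * c) ≡ (d + x * c) + c
        lem = solve-∀
        row : ∀ s → s < N → ∑ N (λ t → S n (λ B → φ (G B s) * f (G B t))) ≡ d + suc N′ * c
        -- One extra `c` on the diagonal completes the row to `N` copies of `c` plus one `d`.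
        row s s<N = +-cancelʳ-≡ c _ _ (begin
          ∑ N e + c                                  ≡⟨ cong (∑ N e +_) (sym (∑-δ N s (λ _ → c) s<N)) ⟩
          ∑ N e + ∑ N (λ t → χ (s ≡ᵇ t) * c)         ≡⟨ sym (∑-+ N e _) ⟩
          ∑ N (λ t → e t + χ (s ≡ᵇ t) * c)           ≡⟨ ∑-cong N cell ⟩
          ∑ N (λ t → χ (s ≡ᵇ t) * d + c)             ≡⟨ ∑-+ N _ _ ⟩
          ∑ N (λ t → χ (s ≡ᵇ t) * d) + ∑ N (λ _ → c) ≡⟨ cong₂ _+_ (∑-δ N s (λ _ → d) s<N) (∑-const N c) ⟩
          d + N * c                                  ≡⟨ lem d c (suc N′) ⟩
          (d + suc N′ * c) + c                       ∎)
          where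
          e : ℕ → ℕ
          e t = S n (λ B → φ (G B s) * f (G B t))
          cell : ∀ t → t < N → e t + χ (s ≡ᵇ t) * c ≡ χ (s ≡ᵇ t) * d + c
          cell t t<N with s ≟ t
          ... | yes refl rewrite ≡ᵇ-yes {s} refl =
            cong₂ _+_ (trans (S-one (λ a → φ a * f a) s s<N) (sym (+-identityʳ d))) (+-identityʳ c)
          ... | no ne rewrite ≡ᵇ-no ne = trans (+-identityʳ _) (S-two φ f s t s<N t<N ne)

      -- The factor `N` cancels between `S-Head` and `S-product`; multiplying by `(k+1)(k+2)` then
      -- clears the denominators of both the one-element and the two-element law.
      E-Head : ∀ f → suc k * (suc (suc k) * S n (Head f))
        ≡ #perms n * (suc (suc k) * ∑ (suc k) (λ a → φ a * f a)
                  + suc N′ * (∑ (suc k) φ * ∑ (suc k) f + ∑ (suc k) (λ a → φ a * f a)))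
      E-Head f = begin
        suc k * (suc (suc k) * S n (Head f))
          ≡⟨ cong (λ s → suc k * (suc (suc k) * s)) (*-cancelˡ-≡ (S n (Head f)) (d + suc N′ * c) N (trans (S-Head f) (S-product f))) ⟩
        suc k * (suc (suc k) * (d + suc N′ * c))
          ≡⟨ lem (suc k) (suc (suc k)) d (suc N′) c ⟩
        suc (suc k) * (suc k * d) + suc N′ * (suc k * (suc (suc k) * c))
          ≡⟨ cong₂ (λ x y → suc (suc k) * x + suc N′ * y) (E-one (λ a → φ a * f a)) (E-two φ f) ⟩
        suc (suc k) * (#perms n * x) + suc N′ * (#perms n * y)
          ≡⟨ lem′ (suc (suc k)) (#perms n) x (suc N′) y ⟩
        #perms n * (suc (suc k) * x + suc N′ * y) ∎
        where
        open ≡-Reasoning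
        c d x y : ℕ
        c = S n (λ B → φ (G B 0) * f (G B 1))
        d = S n (λ B → φ (G B 0) * f (G B 0))
        x = ∑ (suc k) (λ a → φ a * f a)
        y = ∑ (suc k) φ * ∑ (suc k) f + ∑ (suc k) (λ a → φ a * f a)
        lem : ∀ a b d m c → a * (b * (d + m * c)) ≡ b * (a * d) + m * (a * (b * c))
        lem = solve-∀
        lem′ : ∀ b t x m y → b * (t * x) + m * (t * y) ≡ t * (b * x + m * y)
        lem′ = solve-∀

  -- The run of the algorithm on a fixed array

  opaque
    unfolding ∑

    ∑-last : ∀ n (f : ℕ → ℕ) → ∑ (suc n) f ≡ f n + ∑ n f
    ∑-last n f = refl

    ∑-empty : ∀ (f : ℕ → ℕ) → ∑ 0 f ≡ 0
    ∑-empty f = refl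

  true⇒T : ∀ {b} → b ≡ true → T b
  true⇒T refl = tt

  false⇒¬T : ∀ {b} → b ≡ false → ¬ T b
  false⇒¬T refl ()

  set-other : ∀ A p v t → t ≢ p → set A p v t ≡ A t
  set-other A p v t t≢p with t ≡ᵇ p in eq
  ... | false = refl
  ... | true  = ⊥-elim (t≢p (≡ᵇ⇒≡ t p (true⇒T eq)))

  rotGo-other : ∀ tmp A cur rest t → t ≢ cur → All (t ≢_) rest → rotGo tmp A cur rest t ≡ A t
  rotGo-other tmp A cur []          t p []       = set-other A cur tmp t p
  rotGo-other tmp A cur (nx ∷ rest) t p (q ∷ qs) =
    trans (rotGo-other tmp (set A cur (A nx)) nx rest t q qs) (set-other A cur (A nx) t p)

  -- The cost count uses only this about the contents after a rotation: it guarantees that unread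
  -- cells still hold the input.
  rotate-other : ∀ A idx t → All (t ≢_) idx → rotate A idx t ≡ A t
  rotate-other A []        t []       = refl
  rotate-other A (i ∷ idx) t (p ∷ ps) = rotGo-other (A i) A i idx t p ps

  asc-All : ∀ {P : ℕ → Set} lo hi → (∀ t → lo ≤ t → t ≤ hi → P t) → All P (asc lo hi)
  asc-All lo hi h = All.map⁺ (All.applyUpTo⁺₁ id (suc hi ∸ lo)
    (λ {t} t< → h (lo + t) (m≤m+n lo t) (≤-pred (<-≤-trans (+-monoʳ-< lo t<) (bound (suc hi) t t<)))))
    where
    bound : ∀ q t → t < q ∸ lo → lo + (q ∸ lo) ≤ q
    bound q t t< = ≤-reflexive (m+[n∸m]≡n (<⇒≤ (m∸n≢0⇒n<m {q} {lo} (λ e → n≮0 (subst (t <_) e t<)))))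

  desc-All : ∀ {P : ℕ → Set} hi lo → (∀ t → lo ≤ t → t ≤ hi → P t) → All P (desc hi lo)
  desc-All hi lo h = All-resp-↭ (↭-sym (↭-reverse (asc lo hi))) (asc-All lo hi h)

  length-asc : ∀ (b : ℕ → ℕ) lo hi → length (map b (asc lo hi)) ≡ suc hi ∸ lo
  length-asc b lo hi = trans (length-map b (asc lo hi)) (trans (length-map (lo +_) (upTo (suc hi ∸ lo))) (length-upTo (suc hi ∸ lo)))

  length-desc : ∀ (b : ℕ → ℕ) hi lo → length (map b (desc hi lo)) ≡ suc hi ∸ lo
  length-desc b hi lo = trans (length-map b (desc hi lo)) (trans (length-reverse (asc lo hi)) (trans (sym (length-map b (asc lo hi))) (length-asc b lo hi)))

  inRange-sound : ∀ lo hi t → T (inRange lo hi t) → lo ≤ t × t ≤ hi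
  inRange-sound lo hi t h = let p , q = Equivalence.to T-∧ h in ≤ᵇ⇒≤ lo t p , ≤ᵇ⇒≤ t hi q

  inRange-complete : ∀ {lo hi t} → lo ≤ t → t ≤ hi → T (inRange lo hi t)
  inRange-complete p q = Equivalence.from T-∧ (≤⇒≤ᵇ p , ≤⇒≤ᵇ q)

  -- The indices below `lo` and those in the range make up the indices below `hi + 1`. The sum is
  -- shifted because the inner pointers start at `b_1`; index 0 is out of range by `1 ≤ lo`.
  ∑-inRange : ∀ K lo hi → 1 ≤ lo → lo ≤ suc hi → hi ≤ K → ∑ K (λ t → χ (inRange lo hi (suc t))) ≡ suc hi ∸ lo
  ∑-inRange K lo hi 1≤lo lo≤ hi≤K = begin
    ∑ K (λ t → ι (suc t))            ≡⟨ cong (_+ ∑ K (λ t → ι (suc t))) (sym (χ-false (λ h → <⇒≱ 1≤lo (proj₁ (inRange-sound lo hi 0 h))))) ⟩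
    ι 0 + ∑ K (λ t → ι (suc t))      ≡⟨ sym (∑-head K ι) ⟩
    ∑ (suc K) ι                      ≡⟨ sym (m+n∸n≡m _ lo) ⟩
    ∑ (suc K) ι + lo ∸ lo            ≡⟨ cong (λ l → ∑ (suc K) ι + l ∸ lo) (sym (∑-χ< (suc K) lo (≤-trans lo≤ (s≤s hi≤K)))) ⟩
    ∑ (suc K) ι + ∑ (suc K) (λ t → χ (t <ᵇ lo)) ∸ lo ≡⟨ cong (_∸ lo) (sym (∑-+ (suc K) ι _)) ⟩
    ∑ (suc K) (λ t → ι t + χ (t <ᵇ lo)) ∸ lo ≡⟨ cong (_∸ lo) (∑-cong (suc K) (λ t _ → cell t)) ⟩
    ∑ (suc K) (λ t → χ (t <ᵇ suc hi)) ∸ lo ≡⟨ cong (_∸ lo) (∑-χ< (suc K) (suc hi) (s≤s hi≤K)) ⟩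
    suc hi ∸ lo ∎
    where
    open ≡-Reasoning
    ι : ℕ → ℕ
    ι t = χ (inRange lo hi t)
    cell : ∀ t → ι t + χ (t <ᵇ lo) ≡ χ (t <ᵇ suc hi)
    cell t with t <? lo
    ... | yes lt = trans (cong₂ _+_ (χ-false (λ h → <⇒≱ lt (proj₁ (inRange-sound lo hi t h)))) (<ᵇ-yes lt))
                         (sym (<ᵇ-yes (<-≤-trans lt lo≤)))
    ... | no nlt with t ≤? hi
    ...   | yes le = trans (cong₂ _+_ (χ-true (inRange-complete (≮⇒≥ nlt) le)) (<ᵇ-no (≮⇒≥ nlt))) (sym (<ᵇ-yes (s≤s le)))
    ...   | no nle = trans (cong₂ _+_ (χ-false (λ h → nle (proj₂ (inRange-sound lo hi t h)))) (<ᵇ-no (≮⇒≥ nlt))) (sym (<ᵇ-no (≰⇒> nle)))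

  incr-lower : ∀ b lo hi t → b t ≤ incr b lo hi t
  incr-lower b lo hi t with inRange lo hi t
  ... | true  = n≤1+n _
  ... | false = ≤-refl

  incr-upper : ∀ b lo hi t → incr b lo hi t ≤ suc (b t)
  incr-upper b lo hi t with inRange lo hi t
  ... | true  = ≤-refl
  ... | false = n≤1+n _

  incr-above : ∀ b lo hi t → hi < t → incr b lo hi t ≡ b t
  incr-above b lo hi t hi<t with inRange lo hi t in eq
  ... | true  = ⊥-elim (<⇒≱ hi<t (proj₂ (inRange-sound lo hi t (true⇒T eq))))
  ... | false = refl

  decr-lower : ∀ b lo hi t → b t ∸ 1 ≤ decr b lo hi t
  decr-lower b lo hi t with inRange lo hi t
  ... | true  = ≤-refl
  ... | false = m∸n≤m (b t) 1

  decr-upper : ∀ b lo hi t → decr b lo hi t ≤ b t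
  decr-upper b lo hi t with inRange lo hi t
  ... | true  = m∸n≤m (b t) 1
  ... | false = ≤-refl

  decr-below : ∀ b lo hi t → t < lo → decr b lo hi t ≡ b t
  decr-below b lo hi t t<lo with inRange lo hi t in eq
  ... | true  = ⊥-elim (<⇒≱ t<lo (proj₁ (inRange-sound lo hi t (true⇒T eq))))
  ... | false = refl

  -- A pointer that has never been below its starting value `c` moves away from it, so every
  -- increment adds exactly one to the distance. In `decr-dist`, the bound `1 ≤ b t` moreover rules
  -- out truncation.
  incr-dist : ∀ b lo hi t c → (T (inRange lo hi t) → c ≤ b t) →
    ∣ incr b lo hi t - c ∣ ≡ ∣ b t - c ∣ + χ (inRange lo hi t)
  incr-dist b lo hi t c h with inRange lo hi t
  ... | false = sym (+-identityʳ _)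
  ... | true  = begin
    ∣ suc (b t) - c ∣  ≡⟨ m≤n⇒∣n-m∣≡n∸m (m≤n⇒m≤1+n (h tt)) ⟩
    suc (b t) ∸ c      ≡⟨ +-∸-assoc 1 (h tt) ⟩
    suc (b t ∸ c)      ≡⟨ cong suc (sym (m≤n⇒∣n-m∣≡n∸m (h tt))) ⟩
    suc ∣ b t - c ∣    ≡⟨ +-comm 1 _ ⟩
    ∣ b t - c ∣ + 1    ∎
    where open ≡-Reasoning

  decr-dist : ∀ b lo hi t c → (T (inRange lo hi t) → 1 ≤ b t × b t ≤ c) →
    ∣ decr b lo hi t - c ∣ ≡ ∣ b t - c ∣ + χ (inRange lo hi t)
  decr-dist b lo hi t c h with inRange lo hi t
  ... | false = sym (+-identityʳ _)
  ... | true with b t | h tt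
  ...   | suc v | _ , v<c = begin
    ∣ v - c ∣          ≡⟨ m≤n⇒∣m-n∣≡n∸m (<⇒≤ v<c) ⟩
    c ∸ v              ≡⟨ +-∸-assoc 1 v<c ⟩
    suc (c ∸ suc v)    ≡⟨ cong suc (sym (m≤n⇒∣m-n∣≡n∸m v<c)) ⟩
    suc ∣ suc v - c ∣  ≡⟨ +-comm 1 _ ⟩
    ∣ suc v - c ∣ + 1  ∎
    where open ≡-Reasoning

  -- w g is the number of pointers that move when an element of group g is placed.
  module Weights (m : ℕ) where

    w : ℕ → ℕ
    w g = if g <ᵇ m then m ∸ g else suc (g ∸ m)

    left right lastLeft firstRight : ℕ → ℕ
    left g = χ (g <ᵇ m)
    right g = χ (m ≤ᵇ g)
    lastLeft g = χ (suc g ≡ᵇ m)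
    firstRight g = χ (g ≡ᵇ m)

    w-left : ∀ {g} → g < m → w g ≡ m ∸ g
    w-left {g} h with g <ᵇ m in eq
    ... | true  = refl
    ... | false = ⊥-elim (false⇒¬T eq (<⇒<ᵇ h))

    w-right : ∀ {g} → m ≤ g → w g ≡ suc (g ∸ m)
    w-right {g} h with g <ᵇ m in eq
    ... | true  = ⊥-elim (≤⇒≯ h (<ᵇ⇒< g m (true⇒T eq)))
    ... | false = refl

    right-left : ∀ {g} → g < m → right g ≡ 0
    right-left h = χ-false (<⇒≱ h ∘ ≤ᵇ⇒≤ m _)

    right-right : ∀ {g} → m ≤ g → right g ≡ 1
    right-right h = χ-true (≤⇒≤ᵇ h)

  module Partition (k : ℕ) (1≤k : 1 ≤ k) (A0 : Arr) (N : ℕ) where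

    open Exchange k A0
    open Weights m

    -- `m` unfolds to `suc h`, so `h` is `m - 1`: the last left group and the index of the last left
    -- inner pointer.
    n h : ℕ
    n = k + N
    h = ⌊ k /2⌋

    h<k : h < k
    h<k = lem k 1≤k
      where
      lem : ∀ k → 1 ≤ k → ⌊ k /2⌋ < k
      lem (suc k) _ = ⌊n/2⌋<n k

    g : ℕ → ℕ
    g r = grp (A0 (suc (k + r)))

    countLess≤ : ∀ B x t → countLess B x t ≤ t
    countLess≤ B x zero    = z≤n
    countLess≤ B x (suc t) = +-mono-≤ (χ≤1 (B (suc t) <ᵇ x)) (countLess≤ B x t)

    g≤k : ∀ r → g r ≤ k
    g≤k r = countLess≤ A0 (A0 (suc (k + r))) k

    L : ℕ → (ℕ → ℕ) → ℕ
    L x f = ∑ x (λ r → f (g r))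

    R : ℕ → ℕ → (ℕ → ℕ) → ℕ
    R s y f = ∑ y (λ r → f (g (s + r)))

    L-suc : ∀ x f {v} → f (g x) ≡ v → L (suc x) f ≡ v + L x f
    L-suc x f e = trans (∑-last x _) (cong (_+ L x f) e)

    R-suc : ∀ s y f {v} → f (g s) ≡ v → R s (suc y) f ≡ v + R (suc s) y f
    R-suc s y f e = trans (∑-head y _) (cong₂ _+_ (trans (cong (f ∘ g) (+-identityʳ s)) e)
      (∑-cong y (λ t _ → cong (f ∘ g) (+-suc s t))))

    travel : (ℕ → ℕ) → ℕ
    travel b = ∑ (k ∸ 1) (λ t → ∣ b (suc t) - initB n (suc t) ∣)

    initB-left : ∀ {t} → t < m → initB n t ≡ suc k
    initB-left {t} t<m with t <ᵇ m in eq
    ... | true  = refl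
    ... | false = ⊥-elim (false⇒¬T eq (<⇒<ᵇ t<m))

    initB-right : ∀ {t} → m ≤ t → initB n t ≡ n
    initB-right {t} m≤t with t <ᵇ m in eq
    ... | true  = ⊥-elim (≤⇒≯ m≤t (<ᵇ⇒< t m (true⇒T eq)))
    ... | false = refl

    -- x elements have been read from the left and y from the right; the non-pivots with
    -- indices in [x, s) are still to be read.
    record Inv (σ : State) (x s y : ℕ) : Set where
      constructor inv
      field
        x≤s   : x ≤ s
        total : s + y ≡ N
        pi≡   : State.pi σ ≡ suc (k + x)
        pj≡   : State.pj σ ≡ k + s
        -- Makes the group found under a pointer equal to a group of the input.
        arr≡  : ∀ r → x ≤ r → r < s → State.arr σ (suc (k + r)) ≡ A0 (suc (k + r))
        -- The bounds by `i` and, in `bR`, by `j` keep the inner pointers off the interior of the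
        -- unread part, which preserves `arr≡`; the bounds by the starting values make each move
        -- count in `travel`.
        bL    : ∀ t → t < m → suc k ≤ State.pb σ t × State.pb σ t ≤ suc (k + x)
        bR    : ∀ t → m ≤ t → k + s ≤ State.pb σ t × State.pb σ t ≤ n
        se    : x + y + travel (State.pb σ) ≡ L x w + R s y w
        wa≡   : State.wa σ + (L x lastLeft + R s y firstRight) ≡ L x w + R s y w
        -- Each rotation adds one more to the assignments than to the write accesses. There is one
        -- rotation per read, except that a stay needs none and a swap, counted by `L x right`,
        -- serves two reads.
        as≡   : State.as σ + (L x lastLeft + R s y firstRight) + L x right ≡ State.wa σ + (x + y)
        bal   : L x right ≡ R s y left

    travel-incr : ∀ b p → p ≤ h → (∀ t → t < m → suc k ≤ b t) →
      travel (incr b (suc p) h) ≡ travel b + (h ∸ p)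
    travel-incr b p p≤h bl = trans (∑-cong (k ∸ 1) (λ t _ → incr-dist b (suc p) h (suc t) (initB n (suc t))
        (λ r → let le = s≤s (proj₂ (inRange-sound (suc p) h (suc t) r)) in
               subst (_≤ b (suc t)) (sym (initB-left le)) (bl (suc t) le))))
      (trans (∑-+ (k ∸ 1) _ _) (cong (travel b +_) (∑-inRange (k ∸ 1) (suc p) h (s≤s z≤n) (s≤s p≤h) (∸-monoˡ-≤ 1 h<k))))

    travel-decr : ∀ b q → m ≤ q → q ≤ k → (∀ t → m ≤ t → 1 ≤ b t × b t ≤ n) →
      travel (decr b m (q ∸ 1)) ≡ travel b + (q ∸ m)
    travel-decr b (suc q) m≤q q≤k br = trans (∑-cong (k ∸ 1) (λ t _ → decr-dist b m q (suc t) (initB n (suc t))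
        (λ r → let le = proj₁ (inRange-sound m q (suc t) r) in
               subst (λ c → 1 ≤ b (suc t) × b (suc t) ≤ c) (sym (initB-right le)) (br (suc t) le))))
      (trans (∑-+ (k ∸ 1) _ _) (cong (travel b +_) (∑-inRange (k ∸ 1) m q (s≤s z≤n) m≤q (∸-monoˡ-≤ 1 q≤k))))

    w-len : ∀ {p} → p ≤ h → w p ≡ suc (h ∸ p)
    w-len p≤h = trans (w-left (s≤s p≤h)) (+-∸-assoc 1 p≤h)

    pred-suc-∸ : ∀ q → m ≤ q → suc (q ∸ 1) ∸ m ≡ q ∸ m
    pred-suc-∸ (suc q) _ = refl

    lastLeft-right : ∀ {p} → m ≤ p → lastLeft p ≡ 0
    lastLeft-right m≤p = ≡ᵇ-no (>⇒≢ (s≤s m≤p))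

    firstRight-left : ∀ {p} → p < m → firstRight p ≡ 0
    firstRight-left p<m = ≡ᵇ-no (<⇒≢ p<m)

    index-≢ : ∀ x r → x ≤ r → ∀ {v} → v ≤ suc (k + x) → suc (k + suc r) ≢ v
    index-≢ x r x≤r v≤ = >⇒≢ (≤-<-trans v≤ (s≤s (+-monoʳ-< k (s≤s x≤r))))

    step1 : ∀ {σ x s y} → Inv σ x s y → x < s → g x < m → Inv (body1 σ) (suc x) s y
    step1 {st A _ _ b wσ aσ} {x} {s} {y} (inv _ tot refl refl ar bl br se wa as bal) x<s gx<m =
      go (grp (A (suc (k + x)))) (cong grp (ar x ≤-refl x<s))
      where
      -- The test in `body1` concerns the group found in the current array; as a variable `p` it can
      -- be replaced by the group `g x` of the input.
      go : ∀ p → p ≡ g x → let idx = suc (k + x) ∷ map b (desc h (suc p)) ; l = length idx in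
        Inv (if suc p <ᵇ m then st (rotate A idx) (suc (suc (k + x))) (k + s) (incr b (suc p) h) (wσ + l) (aσ + suc l)
                           else st A (suc (suc (k + x))) (k + s) b wσ aσ) (suc x) s y
      go p refl with suc (g x) <ᵇ m in eq
      -- Group `m - 1`: only `i` moves and nothing is written, so the weight 1 is compensated by
      -- `lastLeft`.
      ... | false = record
        { x≤s = x<s ; total = tot ; pi≡ = cong suc (sym (+-suc k x)) ; pj≡ = refl
        ; arr≡ = λ r x<r → ar r (<⇒≤ x<r)
        ; bL = λ t t<m → proj₁ (bl t t<m) , ≤-trans (proj₂ (bl t t<m)) (s≤s (+-monoʳ-≤ k (n≤1+n x)))
        ; bR = br
        ; se = trans (cong suc se) (cong (_+ R s y w) (sym (L-suc x w w1)))
        ; wa≡ = trans (cong (λ v → wσ + (v + R s y firstRight)) (L-suc x lastLeft l1))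
                  (trans (trans (+-suc wσ _) (cong suc wa)) (cong (_+ R s y w) (sym (L-suc x w w1))))
        ; as≡ = trans (cong₂ (λ u v → aσ + (u + R s y firstRight) + v) (L-suc x lastLeft l1) (L-suc x right (right-left gx<m)))
                  (trans (cong (_+ L x right) (+-suc aσ _)) (trans (cong suc as) (sym (+-suc wσ _))))
        ; bal = trans (L-suc x right (right-left gx<m)) bal
        }
        where
        m≡ : suc (g x) ≡ m
        m≡ = ≤-antisym gx<m (≮⇒≥ (false⇒¬T eq ∘ <⇒<ᵇ))
        w1 : w (g x) ≡ 1
        w1 = trans (w-left gx<m) (trans (cong (_∸ g x) (sym m≡)) (m+n∸n≡m 1 (g x)))
        l1 : lastLeft (g x) ≡ 1
        l1 = ≡ᵇ-yes m≡
      ... | true = record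
        { x≤s = x<s ; total = tot ; pi≡ = cong suc (sym (+-suc k x)) ; pj≡ = refl
        ; arr≡ = arr′
        ; bL = λ t t<m → ≤-trans (proj₁ (bl t t<m)) (incr-lower b _ h t) ,
                 ≤-trans (incr-upper b _ h t) (subst (suc (b t) ≤_) (cong suc (sym (+-suc k x))) (s≤s (proj₂ (bl t t<m))))
        ; bR = λ t m≤t → subst (λ v → k + s ≤ v × v ≤ n) (sym (incr-above b _ h t m≤t)) (br t m≤t)
        ; se = trans (cong (suc x + y +_) (travel-incr b (g x) gx≤h (λ t t<m → proj₁ (bl t t<m))))
                 (trans (lem₁ x y (travel b) (h ∸ g x)) (trans (cong (suc (h ∸ g x) +_) se) endW))
        ; wa≡ = trans (cong₂ (λ l v → wσ + l + (v + R s y firstRight)) len (L-suc x lastLeft l0))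
                  (trans (lem₂ wσ (suc (h ∸ g x)) _) (trans (cong (suc (h ∸ g x) +_) wa) endW))
        ; as≡ = trans (cong (λ u → aσ + suc (length idx) + (u + R s y firstRight) + L (suc x) right) (L-suc x lastLeft l0))
                  (trans (cong (λ v → aσ + suc (length idx) + (L x lastLeft + R s y firstRight) + v) (L-suc x right (right-left gx<m)))
                  (trans (lem₃ aσ (length idx) _ (L x right)) (trans (cong (suc (length idx) +_) as) (lem₄ wσ (length idx) x y))))
        ; bal = trans (L-suc x right (right-left gx<m)) bal
        }
        where
        gx≤h : g x ≤ h
        gx≤h = ≤-pred gx<m
        idx : List ℕ
        idx = suc (k + x) ∷ map b (desc h (suc (g x)))
        len : length idx ≡ suc (h ∸ g x)
        len = cong suc (length-desc b h (suc (g x)))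
        l0 : lastLeft (g x) ≡ 0
        l0 = ≡ᵇ-no (<⇒≢ (<ᵇ⇒< (suc (g x)) m (true⇒T eq)))
        arr′ : ∀ r → suc x ≤ r → r < s → rotate A idx (suc (k + r)) ≡ A0 (suc (k + r))
        arr′ (suc r) (s≤s x≤r) r<s = trans (rotate-other A idx _ (index-≢ x r x≤r ≤-refl ∷
            All.map⁺ (desc-All h (suc (g x)) (λ t _ t≤h → index-≢ x r x≤r (proj₂ (bl t (s≤s t≤h)))))))
          (ar (suc r) (m≤n⇒m≤1+n x≤r) r<s)
        endW : suc (h ∸ g x) + (L x w + R s y w) ≡ L (suc x) w + R s y w
        endW = trans (sym (+-assoc (suc (h ∸ g x)) _ _)) (cong (_+ R s y w) (sym (L-suc x w (w-len gx≤h))))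
        lem₁ : ∀ x y S d → suc x + y + (S + d) ≡ suc d + (x + y + S)
        lem₁ = solve-∀
        lem₂ : ∀ a l c → a + l + c ≡ l + (a + c)
        lem₂ = solve-∀
        lem₃ : ∀ a l c d → a + suc l + c + (0 + d) ≡ suc l + (a + c + d)
        lem₃ = solve-∀
        lem₄ : ∀ a l x y → suc l + (a + (x + y)) ≡ a + l + (suc x + y)
        lem₄ = solve-∀

    -- Right pointers stay at `k` or beyond, so for `k ≥ 1` the truncated `∸ 1` really moves them by
    -- one.
    1≤bR : ∀ {s v} → 1 ≤ k → k + s ≤ v → 1 ≤ v
    1≤bR p q = ≤-trans p (≤-trans (m≤m+n k _) q)

    index-≢′ : ∀ s r → r < s → ∀ {v} → k + suc s ≤ v → suc (k + r) ≢ v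
    index-≢′ s r r<s {v} le = <⇒≢ (<-≤-trans (s≤s (+-monoʳ-< k r<s)) (subst (_≤ v) (+-suc k s) le))

    pred-pj : ∀ s → k + suc s ∸ 1 ≡ k + s
    pred-pj s = cong (_∸ 1) (+-suc k s)

    total-suc : ∀ s y → suc s + y ≡ N → s + suc y ≡ N
    total-suc s y e = trans (+-suc s y) e

    step2 : ∀ {σ x s y} → Inv σ x (suc s) y → x ≤ s → m ≤ g s → Inv (body2 σ) x s (suc y)
    step2 {st A _ _ b wσ aσ} {x} {s} {y} (inv _ tot refl refl ar bl br se wa as bal) x≤s m≤gs =
      go (grp (A (k + suc s))) (cong grp (trans (cong A (+-suc k s)) (ar s x≤s ≤-refl)))
      where
      go : ∀ q → q ≡ g s → let idx = (k + suc s) ∷ map b (asc m (q ∸ 1)) ; l = length idx in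
        Inv (if m <ᵇ q then st (rotate A idx) (suc (k + x)) (k + suc s ∸ 1) (decr b m (q ∸ 1)) (wσ + l) (aσ + suc l)
                       else st A (suc (k + x)) (k + suc s ∸ 1) b wσ aσ) x s (suc y)
      go q refl with m <ᵇ g s in eq
      -- Group `m` read from the right: only `j` moves, and `firstRight` compensates the weight 1.
      ... | false = record
        { x≤s = x≤s ; total = total-suc s y tot ; pi≡ = refl ; pj≡ = pred-pj s
        ; arr≡ = λ r x≤r r<s → ar r x≤r (m≤n⇒m≤1+n r<s)
        ; bL = bl
        ; bR = λ t m≤t → ≤-trans (+-monoʳ-≤ k (n≤1+n s)) (proj₁ (br t m≤t)) , proj₂ (br t m≤t)
        ; se = trans (cong (_+ travel b) (+-suc x y)) (trans (cong suc se) endW)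
        ; wa≡ = trans (cong (λ v → wσ + (L x lastLeft + v)) (R-suc s y firstRight f1))
                  (trans (lem₁ wσ (L x lastLeft) _) (trans (cong suc wa) endW))
        ; as≡ = trans (cong (λ v → aσ + (L x lastLeft + v) + L x right) (R-suc s y firstRight f1))
                  (trans (cong (_+ L x right) (lem₁ aσ (L x lastLeft) _)) (trans (cong suc as) (sym (lem₁ wσ x y))))
        ; bal = trans bal (sym (R-suc s y left (<ᵇ-no m≤gs)))
        }
        where
        m≡ : g s ≡ m
        m≡ = ≤-antisym (≮⇒≥ (false⇒¬T eq ∘ <⇒<ᵇ)) m≤gs
        w1 : w (g s) ≡ 1
        w1 = trans (w-right m≤gs) (cong suc (trans (cong (_∸ m) m≡) (n∸n≡0 m)))
        f1 : firstRight (g s) ≡ 1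
        f1 = ≡ᵇ-yes m≡
        lem₁ : ∀ a b c → a + (b + suc c) ≡ suc (a + (b + c))
        lem₁ = solve-∀
        endW : suc (L x w + R (suc s) y w) ≡ L x w + R s (suc y) w
        endW = trans (sym (+-suc (L x w) _)) (cong (L x w +_) (sym (R-suc s y w w1)))
      ... | true = record
        { x≤s = x≤s ; total = total-suc s y tot ; pi≡ = refl ; pj≡ = pred-pj s
        ; arr≡ = λ r x≤r r<s → trans (rotate-other A idx _ (index-≢′ s r r<s ≤-refl ∷
            All.map⁺ (asc-All m (g s ∸ 1) (λ t m≤t _ → index-≢′ s r r<s (proj₁ (br t m≤t))))))
            (ar r x≤r (m≤n⇒m≤1+n r<s))
        ; bL = λ t t<m → subst (λ v → suc k ≤ v × v ≤ suc (k + x)) (sym (decr-below b m _ t t<m)) (bl t t<m)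
        ; bR = λ t m≤t → ≤-trans (≤-trans (≤-reflexive (sym (pred-pj s))) (∸-monoˡ-≤ 1 (proj₁ (br t m≤t)))) (decr-lower b m _ t) ,
                 ≤-trans (decr-upper b m _ t) (proj₂ (br t m≤t))
        ; se = trans (cong (x + suc y +_) (travel-decr b (g s) m≤gs (g≤k s) (λ t m≤t → 1≤bR 1≤k (proj₁ (br t m≤t)) , proj₂ (br t m≤t))))
                 (trans (lem₁ x y (travel b) (g s ∸ m)) (trans (cong (suc (g s ∸ m) +_) se) endW))
        ; wa≡ = trans (cong₂ (λ l v → wσ + l + (L x lastLeft + v)) len (R-suc s y firstRight f0))
                  (trans (lem₂ wσ (suc (g s ∸ m)) _) (trans (cong (suc (g s ∸ m) +_) wa) endW))
        ; as≡ = trans (cong (λ v → aσ + suc (length idx) + (L x lastLeft + v) + L x right) (R-suc s y firstRight f0))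
                  (trans (lem₃ aσ (length idx) _ (L x right)) (trans (cong (suc (length idx) +_) as) (lem₄ wσ (length idx) x y)))
        ; bal = trans bal (sym (R-suc s y left (<ᵇ-no m≤gs)))
        }
        where
        idx : List ℕ
        idx = (k + suc s) ∷ map b (asc m (g s ∸ 1))
        len : length idx ≡ suc (g s ∸ m)
        len = cong suc (trans (length-asc b m (g s ∸ 1)) (pred-suc-∸ (g s) m≤gs))
        f0 : firstRight (g s) ≡ 0
        f0 = ≡ᵇ-no (>⇒≢ (<ᵇ⇒< m (g s) (true⇒T eq)))
        lem₀ : ∀ a b c → a + (b + c) ≡ b + (a + c)
        lem₀ = solve-∀
        endW : suc (g s ∸ m) + (L x w + R (suc s) y w) ≡ L x w + R s (suc y) w
        endW = trans (lem₀ (suc (g s ∸ m)) (L x w) _) (cong (L x w +_) (sym (R-suc s y w (w-right m≤gs))))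
        lem₁ : ∀ x y S d → x + suc y + (S + d) ≡ suc d + (x + y + S)
        lem₁ = solve-∀
        lem₂ : ∀ a l c → a + l + c ≡ l + (a + c)
        lem₂ = solve-∀
        lem₃ : ∀ a l c d → a + suc l + c + d ≡ suc l + (a + c + d)
        lem₃ = solve-∀
        lem₄ : ∀ a l x y → suc l + (a + (x + y)) ≡ a + l + (x + suc y)
        lem₄ = solve-∀

    -- The single rotation lists the cells of both placements, so its length is the sum of the two
    -- weights and no correction arises in `wa≡`. The pointers moved on the left are due to the
    -- element read on the right, and conversely. Both counts in `bal` grow by one.
    step3-inv : ∀ {σ x s y} → Inv σ x (suc s) y → x < s → m ≤ g x → g s < m → Inv (body3 σ) (suc x) s (suc y)
    step3-inv {st A _ _ b wσ aσ} {x} {s} {y} (inv _ tot refl refl ar bl br se wa as bal) x<s m≤gx gs<m =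
      go (grp (A (suc (k + x)))) (grp (A (k + suc s))) (cong grp (ar x ≤-refl (m≤n⇒m≤1+n x<s)))
         (cong grp (trans (cong A (+-suc k s)) (ar s (<⇒≤ x<s) ≤-refl)))
      where
      go : ∀ p q → p ≡ g x → q ≡ g s →
        let idx = (suc (k + x) ∷ map b (desc h (suc q))) ++ ((k + suc s) ∷ map b (asc m (p ∸ 1))) ; l = length idx in
        Inv (st (rotate A idx) (suc (suc (k + x))) (k + suc s ∸ 1) (decr (incr b (suc q) h) m (p ∸ 1)) (wσ + l) (aσ + suc l)) (suc x) s (suc y)
      go p q refl refl = record
        { x≤s = x<s ; total = total-suc s y tot ; pi≡ = cong suc (sym (+-suc k x)) ; pj≡ = pred-pj s
        ; arr≡ = arr′
        ; bL = λ t t<m → subst (λ v → suc k ≤ v × v ≤ suc (k + suc x)) (sym (decr-below b′ m _ t t<m))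
                 (≤-trans (proj₁ (bl t t<m)) (incr-lower b _ h t) ,
                  ≤-trans (incr-upper b _ h t) (subst (suc (b t) ≤_) (cong suc (sym (+-suc k x))) (s≤s (proj₂ (bl t t<m)))))
        ; bR = λ t m≤t → ≤-trans (≤-trans (≤-reflexive (sym (pred-pj s))) (∸-monoˡ-≤ 1 (proj₁ (br′ t m≤t)))) (decr-lower b′ m _ t) ,
                 ≤-trans (decr-upper b′ m _ t) (proj₂ (br′ t m≤t))
        ; se = trans (cong (suc x + suc y +_) (trans
                   (travel-decr b′ (g x) m≤gx (g≤k x) (λ t m≤t → 1≤bR 1≤k (proj₁ (br′ t m≤t)) , proj₂ (br′ t m≤t)))
                   (cong (_+ (g x ∸ m)) (travel-incr b (g s) gs≤h (λ t t<m → proj₁ (bl t t<m))))))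
                 (trans (lem₁ x y (travel b) (h ∸ g s) (g x ∸ m)) (trans (cong (ll +_) se) endW))
        ; wa≡ = trans (cong₂ (λ l v → wσ + l + v) len (cong₂ _+_ (L-suc x lastLeft (lastLeft-right m≤gx)) (R-suc s y firstRight (firstRight-left gs<m))))
                  (trans (lem₂ wσ ll _) (trans (cong (ll +_) wa) endW))
        ; as≡ = trans (cong₂ (λ u v → aσ + suc (length idx) + u + v)
                    (cong₂ _+_ (L-suc x lastLeft (lastLeft-right m≤gx)) (R-suc s y firstRight (firstRight-left gs<m)))
                    (L-suc x right (right-right m≤gx)))
                  (trans (lem₃ aσ (length idx) _ (L x right)) (trans (cong (suc (suc (length idx)) +_) as) (lem₄ wσ (length idx) x y)))
        ; bal = trans (L-suc x right (right-right m≤gx)) (trans (cong suc bal) (sym (R-suc s y left (<ᵇ-yes gs<m))))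
        }
        where
        gs≤h : g s ≤ h
        gs≤h = ≤-pred gs<m
        b′ : ℕ → ℕ
        b′ = incr b (suc (g s)) h
        br′ : ∀ t → m ≤ t → k + suc s ≤ b′ t × b′ t ≤ n
        br′ t m≤t = subst (λ v → k + suc s ≤ v × v ≤ n) (sym (incr-above b _ h t m≤t)) (br t m≤t)
        idxL idxR idx : List ℕ
        idxL = suc (k + x) ∷ map b (desc h (suc (g s)))
        idxR = (k + suc s) ∷ map b (asc m (g x ∸ 1))
        idx = idxL ++ idxR
        ll : ℕ
        ll = suc (h ∸ g s) + suc (g x ∸ m)
        len : length idx ≡ ll
        len = trans (length-++ idxL) (cong₂ _+_ (cong suc (length-desc b h (suc (g s))))
                (cong suc (trans (length-asc b m (g x ∸ 1)) (pred-suc-∸ (g x) m≤gx))))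
        arr′ : ∀ r → suc x ≤ r → r < s → rotate A idx (suc (k + r)) ≡ A0 (suc (k + r))
        arr′ (suc r) (s≤s x≤r) r<s = trans (rotate-other A idx _ (All.++⁺
            (index-≢ x r x≤r ≤-refl ∷ All.map⁺ (desc-All h (suc (g s)) (λ t _ t≤h → index-≢ x r x≤r (proj₂ (bl t (s≤s t≤h))))))
            (index-≢′ s (suc r) r<s ≤-refl ∷
              All.map⁺ (asc-All m (g x ∸ 1) (λ t m≤t _ → index-≢′ s (suc r) r<s (proj₁ (br t m≤t)))))))
          (ar (suc r) (m≤n⇒m≤1+n x≤r) (m≤n⇒m≤1+n r<s))
        lem₀ : ∀ a b c d → a + b + (c + d) ≡ (b + c) + (a + d)
        lem₀ = solve-∀
        endW : ll + (L x w + R (suc s) y w) ≡ L (suc x) w + R s (suc y) w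
        endW = trans (lem₀ (suc (h ∸ g s)) (suc (g x ∸ m)) (L x w) (R (suc s) y w))
                 (sym (cong₂ _+_ (L-suc x w (w-right m≤gx)) (R-suc s y w (w-len gs≤h))))
        lem₁ : ∀ x y S d e → suc x + suc y + (S + d + e) ≡ (suc d + suc e) + (x + y + S)
        lem₁ = solve-∀
        lem₂ : ∀ a l c → a + l + c ≡ l + (a + c)
        lem₂ = solve-∀
        lem₃ : ∀ a l c d → a + suc l + c + suc d ≡ suc (suc l) + (a + c + d)
        lem₃ = solve-∀
        lem₄ : ∀ a l x y → suc (suc l) + (a + (x + y)) ≡ a + l + (suc x + suc y)
        lem₄ = solve-∀

    -- Termination of the run and the resulting cost identities

    Done : State → Set
    Done σ = Σ ℕ λ x → Σ ℕ λ s → Σ ℕ λ y → Inv σ x s y × s ≤ suc x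

    -- With z elements left, an inner loop is entered with z ≤ 1 only after the current round
    -- has already consumed an element, which pays for the round.
    fuel : ℕ → ℕ
    fuel 0             = 2
    fuel 1             = 7
    fuel (suc (suc z)) = 8 + z * 5

    fuel-suc : ∀ z → suc (fuel z) ≤ fuel (suc z)
    fuel-suc 0             = s≤s (s≤s (s≤s z≤n))
    fuel-suc 1             = ≤-refl
    fuel-suc (suc (suc z)) = +-monoʳ-≤ 9 (m≤n+m (z * 5) 4)

    i<j⇒ : ∀ {σ x s y} → Inv σ x s y → State.pi σ < State.pj σ → suc x < s
    i<j⇒ I lt = +-cancelˡ-< k _ _ (subst₂ _<_ (trans (Inv.pi≡ I) (sym (+-suc k _))) (Inv.pj≡ I) lt)

    ⇒i<j : ∀ {σ x s y} → Inv σ x s y → suc x < s → State.pi σ < State.pj σ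
    ⇒i<j I lt = subst₂ _<_ (sym (trans (Inv.pi≡ I) (sym (+-suc k _)))) (sym (Inv.pj≡ I)) (+-monoʳ-< k lt)

    i≤j⇒ : ∀ {σ x s y} → Inv σ x s y → State.pi σ ≤ State.pj σ → x < s
    i≤j⇒ I le = +-cancelˡ-≤ k _ _ (subst₂ _≤_ (trans (Inv.pi≡ I) (sym (+-suc k _))) (Inv.pj≡ I) le)

    ⇒i≤j : ∀ {σ x s y} → Inv σ x s y → x < s → State.pi σ ≤ State.pj σ
    ⇒i≤j I le = subst₂ _≤_ (sym (trans (Inv.pi≡ I) (sym (+-suc k _)))) (sym (Inv.pj≡ I)) (+-monoʳ-≤ k le)

    read-i : ∀ {σ x s y} → Inv σ x s y → x < s → grp (State.arr σ (State.pi σ)) ≡ g x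
    read-i {σ} {x} I x<s = cong grp (trans (cong (State.arr σ) (Inv.pi≡ I)) (Inv.arr≡ I x ≤-refl x<s))

    read-j : ∀ {σ x s y} → Inv σ x (suc s) y → x ≤ s → grp (State.arr σ (State.pj σ)) ≡ g s
    read-j {σ} {x} {s} I x≤s = cong grp (trans (cong (State.arr σ) (trans (Inv.pj≡ I) (+-suc k s))) (Inv.arr≡ I s x≤s ≤-refl))

    1≤gap : ∀ z x → x < z + x → ∃ λ z′ → z ≡ suc z′
    1≤gap zero     x lt = ⊥-elim (<-irrefl refl lt)
    1≤gap (suc z′) x _  = z′ , refl

    2≤gap : ∀ z x → suc x < z + x → ∃ λ z′ → z ≡ suc (suc z′)
    2≤gap 0             x lt = ⊥-elim (<⇒≱ lt (n≤1+n x))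
    2≤gap 1             x lt = ⊥-elim (<-irrefl refl lt)
    2≤gap (suc (suc z)) x _  = z , refl

    -- Here `z` is the number of unread elements. Each phase hands on what its exit test has shown:
    -- a right element under `i` after loop (1), a left one under `j` after loop (2), which together
    -- are the hypotheses of `step3-inv`. The guards on `z` are there because without unread
    -- elements the tests say nothing about groups.
    run-outer : ∀ f σ x z y → Inv σ x (z + x) y → 1 + z * 5 ≤ f → Done (run f outer σ)
    run-loop1 : ∀ f σ x z y → Inv σ x (z + x) y → 2 + fuel z ≤ f → Done (run f loop1 σ)
    run-loop2 : ∀ f σ x z y → Inv σ x (z + x) y → (1 ≤ z → m ≤ g x) → 1 + fuel z ≤ f → Done (run f loop2 σ)
    run-step3 : ∀ f σ x z y → Inv σ x (z + x) y → (1 ≤ z → m ≤ g x) → (∀ z′ → z ≡ suc z′ → g (z′ + x) < m) →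
      fuel z ≤ f → Done (run f step3 σ)

    run-outer (suc f) σ x z y I fu with State.pi σ <ᵇ State.pj σ in eq
    ... | false = x , z + x , y , I , ≮⇒≥ (false⇒¬T eq ∘ <⇒<ᵇ ∘ ⇒i<j I)
    ... | true with 2≤gap z x (i<j⇒ I (<ᵇ⇒< _ _ (true⇒T eq)))
    ...   | z′ , refl = run-loop1 f σ x (suc (suc z′)) y I (≤-pred fu)

    run-loop1 (suc f) σ x z y I fu with (State.pi σ ≤ᵇ State.pj σ) ∧ (grp (State.arr σ (State.pi σ)) <ᵇ m) in eq
    ... | false = run-loop2 f σ x z y I
      (λ 1≤z → let x<s = +-monoˡ-≤ x 1≤z in
        ≮⇒≥ (λ lt → false⇒¬T eq (Equivalence.from T-∧
          (≤⇒≤ᵇ (⇒i≤j I x<s) , <⇒<ᵇ (subst (_< m) (sym (read-i I x<s)) lt)))))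
      (≤-pred fu)
    ... | true with Equivalence.to T-∧ (true⇒T eq)
    ...   | le , lt with i≤j⇒ I (≤ᵇ⇒≤ _ _ le)
    ...     | x<s with 1≤gap z x x<s
    ...       | z′ , refl = run-loop1 f (body1 σ) (suc x) z′ y
      (subst (λ s → Inv (body1 σ) (suc x) s y) (sym (+-suc z′ x))
        (step1 I x<s (subst (_< m) (read-i I x<s) (<ᵇ⇒< _ m lt))))
      (≤-trans (s≤s (fuel-suc z′)) (≤-pred fu))

    run-loop2 (suc f) σ x z y I hi fu with (State.pi σ ≤ᵇ State.pj σ) ∧ (m ≤ᵇ grp (State.arr σ (State.pj σ))) in eq
    ... | false = run-step3 f σ x z y I hi
      (λ { z′ refl → ≰⇒> (λ le → false⇒¬T eq (Equivalence.from T-∧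
          (≤⇒≤ᵇ (⇒i≤j I (s≤s (m≤n+m x z′))) , ≤⇒≤ᵇ (subst (m ≤_) (sym (read-j I (m≤n+m x z′))) le)))) })
      (≤-pred fu)
    ... | true with Equivalence.to T-∧ (true⇒T eq)
    ...   | le , ge with i≤j⇒ I (≤ᵇ⇒≤ _ _ le)
    ...     | x<s with 1≤gap z x x<s
    ...       | z′ , refl = run-loop2 f (body2 σ) x z′ (suc y)
      (step2 I (≤-pred x<s) (subst (m ≤_) (read-j I (≤-pred x<s)) (≤ᵇ⇒≤ m _ ge)))
      (λ 1≤z′ → hi (s≤s z≤n)) (≤-trans (fuel-suc z′) (≤-pred fu))

    run-step3 (suc f) σ x z y I hi hj fu with State.pi σ <ᵇ State.pj σ in eq
    ... | true with i<j⇒ I (<ᵇ⇒< _ _ (true⇒T eq))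
    ...   | lt with 2≤gap z x lt
    ...     | z′ , refl = run-outer f (body3 σ) (suc x) z′ (suc y)
      (subst (λ s → Inv (body3 σ) (suc x) s (suc y)) (sym (+-suc z′ x))
        (step3-inv I (≤-pred lt) (hi (s≤s z≤n)) (hj (suc z′) refl)))
      (≤-trans (s≤s (m≤n+m (z′ * 5) 6)) (≤-pred fu))
    run-step3 (suc f) σ x 0 y I hi hj fu | false = run-outer f σ x 0 y I (≤-pred fu)
    run-step3 (suc f) σ x 1 y I hi hj fu | false = run-outer f σ x 1 y I (≤-pred fu)
    run-step3 (suc f) σ x (suc (suc z)) y I hi hj fu | false =
      ⊥-elim (false⇒¬T eq (<⇒<ᵇ (⇒i<j I (s≤s (s≤s (m≤n+m x z))))))
    run-step3 zero σ x 0 y I hi hj ()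
    run-step3 zero σ x 1 y I hi hj ()
    run-step3 zero σ x (suc (suc z)) y I hi hj ()

    init-inv : Inv (init n) 0 (N + 0) 0
    init-inv = record
      { x≤s = z≤n ; total = trans (+-identityʳ (N + 0)) (+-identityʳ N)
      ; pi≡ = cong suc (sym (+-identityʳ k)) ; pj≡ = cong (k +_) (sym (+-identityʳ N))
      ; arr≡ = λ _ _ _ → refl
      ; bL = λ t t<m → ≤-reflexive (sym (initB-left t<m)) , ≤-reflexive (trans (initB-left t<m) (cong suc (sym (+-identityʳ k))))
      ; bR = λ t m≤t → ≤-reflexive (trans (cong (k +_) (+-identityʳ N)) (sym (initB-right m≤t))) , ≤-reflexive (initB-right m≤t)
      ; se = trans (trans (∑-cong (k ∸ 1) (λ t _ → ∣n-n∣≡0 (initB n (suc t)))) (∑-zero (k ∸ 1))) (sym (cong₂ _+_ (∑-empty _) (∑-empty _)))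
      ; wa≡ = trans (cong₂ _+_ (∑-empty _) (∑-empty _)) (sym (cong₂ _+_ (∑-empty _) (∑-empty _)))
      ; as≡ = cong₂ _+_ (cong₂ _+_ (∑-empty _) (∑-empty _)) (∑-empty _)
      ; bal = trans (∑-empty _) (sym (∑-empty _))
      }

    final-inv : Done (final n)
    final-inv = run-outer (10 * (n + 2)) (init n) 0 N 0 init-inv (enough k N)
      where
      lem : ∀ k N → 10 * (k + N + 2) ≡ (1 + N * 5) + (19 + N * 5 + 10 * k)
      lem = solve-∀
      enough : ∀ k N → 1 + N * 5 ≤ 10 * (k + N + 2)
      enough k N = ≤-trans (m≤m+n (1 + N * 5) (19 + N * 5 + 10 * k)) (≤-reflexive (sym (lem k N)))

    sumTo≡∑ : ∀ f K → sumTo f K ≡ ∑ K (λ t → f (suc t))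
    sumTo≡∑ f zero    = sym (∑-empty _)
    sumTo≡∑ f (suc K) = trans (cong (f (suc K) +_) (sumTo≡∑ f K)) (sym (∑-last K _))

    costs : Σ ℕ λ x → Σ ℕ λ s → Σ ℕ λ y → x ≤ s × s ≤ suc x × s + y ≡ N
      × costSE n ≡ L x w + R s y w
      × costWA n + (L x lastLeft + R s y firstRight) ≡ L x w + R s y w
      × costAS n + (L x lastLeft + R s y firstRight) + L x right ≡ costWA n + (x + y)
      × L x right ≡ R s y left
    costs with final-inv
    ... | x , s , y , I , s≤ = x , s , y , Inv.x≤s I , s≤ , Inv.total I ,
      trans (cong₂ _+_ (cong₂ _+_ di dj) (sumTo≡∑ _ (k ∸ 1))) (Inv.se I) , Inv.wa≡ I , Inv.as≡ I , Inv.bal I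
      where
      di : ∣ State.pi (final n) - suc k ∣ ≡ x
      di = trans (cong (λ v → ∣ v - suc k ∣) (Inv.pi≡ I)) (trans (∣-∣-comm (k + x) k) (∣m-m+n∣≡n k x))
      dj : ∣ State.pj (final n) - n ∣ ≡ y
      dj = trans (cong₂ ∣_-_∣ (Inv.pj≡ I) (trans (cong (k +_) (sym (Inv.total I))) (sym (+-assoc k s y)))) (∣m-m+n∣≡n (k + s) y)

  -- Costs up to bounded errors

  ∑-point : ∀ n u (f : ℕ → ℕ) → u < n → ∑ n (λ t → χ (t ≡ᵇ u) * f t) ≡ f u
  ∑-point n u f u<n = trans (∑-cong n (λ t _ → cong (_* f t) (flip t))) (∑-δ n u f u<n)
    where
    flip : ∀ t → χ (t ≡ᵇ u) ≡ χ (u ≡ᵇ t)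
    flip t with t ≟ u
    ... | yes refl = refl
    ... | no ne    = trans (≡ᵇ-no ne) (sym (≡ᵇ-no (≢-sym ne)))

  ∑-point-1 : ∀ n u → u < n → ∑ n (λ t → χ (t ≡ᵇ u)) ≡ 1
  ∑-point-1 n u u<n = trans (∑-cong n (λ t _ → sym (*-identityʳ _))) (∑-point n u (λ _ → 1) u<n)

  ∑-prefix : ∀ n l (f : ℕ → ℕ) → l ≤ n → ∑ n (λ r → χ (r <ᵇ l) * f r) ≡ ∑ l f
  ∑-prefix n l f l≤n = begin
    ∑ n F                                  ≡⟨ cong (λ c → ∑ c F) (sym (m+[n∸m]≡n l≤n)) ⟩
    ∑ (l + (n ∸ l)) F                      ≡⟨ ∑-split l (n ∸ l) F ⟩
    ∑ l F + ∑ (n ∸ l) (λ t → F (l + t))    ≡⟨ cong₂ _+_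
        (∑-cong l (λ t t<l → trans (cong (_* f t) (<ᵇ-yes t<l)) (*-identityˡ (f t))))
        (trans (∑-cong (n ∸ l) (λ t _ → cong (_* f (l + t)) (<ᵇ-no (m≤m+n l t)))) (∑-zero (n ∸ l))) ⟩
    ∑ l f + 0                              ≡⟨ +-identityʳ _ ⟩
    ∑ l f ∎
    where
    open ≡-Reasoning
    F : ℕ → ℕ
    F r = χ (r <ᵇ l) * f r

  ∑-triangle : ∀ n → 2 * ∑ n suc ≡ n * suc n
  ∑-triangle zero    = cong (2 *_) (∑-empty suc)
  ∑-triangle (suc n) = trans (cong (2 *_) (∑-last n suc)) (trans (*-distribˡ-+ 2 (suc n) (∑ n suc))
    (trans (cong (2 * suc n +_) (∑-triangle n)) (lem n)))
    where
    lem : ∀ n → 2 * suc n + n * suc n ≡ suc n * suc (suc n)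
    lem = solve-∀

  ∑-triangle-rev : ∀ n → ∑ n (n ∸_) ≡ ∑ n suc
  ∑-triangle-rev zero    = trans (∑-empty _) (sym (∑-empty _))
  ∑-triangle-rev (suc n) = trans (∑-head n (suc n ∸_)) (trans (cong (suc n +_) (∑-triangle-rev n)) (sym (∑-last n suc)))

  module WeightSums (m r : ℕ) where

    open Weights m

    w≤ : ∀ a → a < m + r → w a ≤ m + r
    w≤ a a< with a <? m
    ... | yes lt = ≤-trans (≤-reflexive (w-left lt)) (≤-trans (m∸n≤m m a) (m≤m+n m r))
    ... | no nlt = ≤-trans (≤-reflexive (w-right (≮⇒≥ nlt))) (≤-trans (s≤s (m∸n≤m a m)) a<)

    left+right : ∀ a → left a + right a ≡ 1
    left+right a with a <? m
    ... | yes lt = cong₂ _+_ (<ᵇ-yes lt) (right-left lt)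
    ... | no nlt = cong₂ _+_ (<ᵇ-no (≮⇒≥ nlt)) (right-right (≮⇒≥ nlt))

    ∑-left : ∑ (m + r) left ≡ m
    ∑-left = ∑-χ< (m + r) m (m≤m+n m r)

    ∑-right : ∑ (m + r) right ≡ r
    ∑-right = +-cancelˡ-≡ m _ _ (trans (cong (_+ ∑ (m + r) right) (sym ∑-left))
      (trans (sym (∑-+ (m + r) left right)) (trans (∑-cong (m + r) (λ a _ → left+right a))
        (trans (∑-const (m + r) 1) (*-identityʳ _)))))

    ∑-left-right : ∑ (m + r) (λ a → left a * right a) ≡ 0
    ∑-left-right = trans (∑-cong (m + r) (λ a _ → cell a)) (∑-zero (m + r))
      where
      cell : ∀ a → left a * right a ≡ 0
      cell a with a <? m
      ... | yes lt = trans (cong (left a *_) (right-left lt)) (*-zeroʳ (left a))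
      ... | no nlt = cong (_* right a) (<ᵇ-no (≮⇒≥ nlt))

    -- The weights in order are `m, ..., 1, 1, ..., r`: two triangular numbers.
    ∑-w : 2 * ∑ (m + r) w ≡ m * suc m + r * suc r
    ∑-w = begin
      2 * ∑ (m + r) w                             ≡⟨ cong (2 *_) (∑-split m r w) ⟩
      2 * (∑ m w + ∑ r (λ t → w (m + t)))         ≡⟨ cong₂ (λ u v → 2 * (u + v))
          (trans (∑-cong m (λ t t<m → w-left t<m)) (∑-triangle-rev m))
          (∑-cong r (λ t _ → trans (w-right (m≤m+n m t)) (cong suc (m+n∸m≡n m t)))) ⟩
      2 * (∑ m suc + ∑ r suc)                     ≡⟨ *-distribˡ-+ 2 (∑ m suc) (∑ r suc) ⟩
      2 * ∑ m suc + 2 * ∑ r suc                   ≡⟨ cong₂ _+_ (∑-triangle m) (∑-triangle r) ⟩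
      m * suc m + r * suc r                       ∎
      where open ≡-Reasoning

  -- Distance at most `C`, written without subtraction so that it survives summation over
  -- permutations in ℕ.
  Close : ℕ → ℕ → ℕ → Set
  Close C a b = a ≤ b + C × b ≤ a + C

  close : ∀ {C a b p q} → a + p ≡ b + q → p ≤ C → q ≤ C → Close C a b
  close {C} {a} {b} {p} {q} e p≤C q≤C =
    ≤-trans (≤-trans (m≤m+n a p) (≤-reflexive e)) (+-monoʳ-≤ b q≤C) ,
    ≤-trans (≤-trans (m≤m+n b q) (≤-reflexive (sym e))) (+-monoʳ-≤ a p≤C)

  module Estimates (k : ℕ) (1≤k : 1 ≤ k) (A0 : Arr) (N : ℕ) where

    open Exchange k A0 using (m; costSE; costWA; costAS)
    open Partition k 1≤k A0 N using (n; g; g≤k; h<k; L; R; costs)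
    open Weights m
    open WeightSums m (suc k ∸ m)

    m+r : m + (suc k ∸ m) ≡ suc k
    m+r = m+[n∸m]≡n (m≤n⇒m≤1+n h<k)

    Full′ : (ℕ → ℕ) → ℕ
    Full′ f = L N f

    Head′ : (ℕ → ℕ) → ℕ
    Head′ f = ∑ N (λ r → χ (r <ᵇ Full′ left) * f (g r))

    L-gap : ∀ x δ f → δ ≤ 1 → L (δ + x) f ≡ δ * f (g x) + L x f
    L-gap x 0 f _ = refl
    L-gap x 1 f _ = trans (∑-last x _) (cong (_+ L x f) (sym (*-identityˡ (f (g x)))))
    L-gap x (suc (suc _)) f (s≤s ())

    L-left+right : ∀ x → L x left + L x right ≡ x
    L-left+right x = trans (sym (∑-+ x _ _)) (trans (∑-cong x (λ t _ → left+right (g t))) (trans (∑-const x 1) (*-identityʳ x)))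

    *-≤1 : ∀ {a b c} → a ≤ 1 → b ≤ c → a * b ≤ c
    *-≤1 {c = c} p q = ≤-trans (*-mono-≤ p q) (≤-reflexive (*-identityˡ c))

    -- The actual reads differ from the ideal sums `Full′` and `Head′` only through the at most one
    -- unread element. Its weight is at most `k + 1`, and each indicator sum is off by at most 1;
    -- the constants add up these errors.
    combine : ∀ {cSE cWA cAS} x s y → x ≤ s → s ≤ suc x → s + y ≡ N →
      cSE ≡ L x w + R s y w →
      cWA + (L x lastLeft + R s y firstRight) ≡ L x w + R s y w →
      cAS + (L x lastLeft + R s y firstRight) + L x right ≡ cWA + (x + y) →
      L x right ≡ R s y left →
      Close (suc k) cSE (Full′ w)
      × Close (suc (suc k)) (cWA + Head′ lastLeft + Full′ firstRight) (Full′ w + Head′ firstRight)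
      × Close 3 (cAS + Head′ lastLeft + Full′ firstRight + Head′ right) (cWA + N + Head′ firstRight)
    combine {cSE} {cWA} {cAS} x s y x≤s s≤ tot se wa as bal =
      close {p = e w} {q = 0}
        (trans (cong (_+ e w) se) (trans (sym (all-eq w)) (sym (+-identityʳ _))))
        w≤k z≤n ,
      close {p = e w + u firstRight} {q = u lastLeft + e firstRight}
        (begin
          cWA + Head′ lastLeft + Full′ firstRight + (e w + u firstRight)
            ≡⟨ cong₂ (λ a b → cWA + a + b + (e w + u firstRight)) (head-eq lastLeft) (all-eq firstRight) ⟩
          cWA + (u lastLeft + L x lastLeft) + (L x firstRight + R s y firstRight + e firstRight) + (e w + u firstRight)
            ≡⟨ arith₁ (cWA) (u lastLeft) (L x lastLeft) (L x firstRight) (R s y firstRight) (e firstRight) (e w) (u firstRight) ⟩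
          cWA + (L x lastLeft + R s y firstRight) + (e w + (u firstRight + L x firstRight) + (u lastLeft + e firstRight))
            ≡⟨ cong (_+ (e w + (u firstRight + L x firstRight) + (u lastLeft + e firstRight))) wa ⟩
          L x w + R s y w + (e w + (u firstRight + L x firstRight) + (u lastLeft + e firstRight))
            ≡⟨ arith₂ (L x w + R s y w) (e w) _ _ ⟩
          L x w + R s y w + e w + (u firstRight + L x firstRight) + (u lastLeft + e firstRight)
            ≡⟨ cong₂ (λ a b → a + b + (u lastLeft + e firstRight)) (sym (all-eq w)) (sym (head-eq firstRight)) ⟩
          Full′ w + Head′ firstRight + (u lastLeft + e firstRight) ∎)
        (≤-trans (+-mono-≤ w≤k (u≤1 firstRight (λ a → χ≤1 _))) (≤-reflexive (+-comm (suc k) 1)))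
        (≤-trans (+-mono-≤ (u≤1 lastLeft (λ a → χ≤1 _)) (e≤1 firstRight (λ a → χ≤1 _))) (s≤s (s≤s z≤n))) ,
      close {p = δ + u firstRight} {q = u lastLeft + e firstRight + u right}
        (begin
          cAS + Head′ lastLeft + Full′ firstRight + Head′ right + (δ + u firstRight)
            ≡⟨ cong (_+ (δ + u firstRight)) (cong₂ _+_ (cong₂ (λ a b → cAS + a + b) (head-eq lastLeft) (all-eq firstRight)) (head-eq right)) ⟩
          cAS + (u lastLeft + L x lastLeft) + (L x firstRight + R s y firstRight + e firstRight) + (u right + L x right) + (δ + u firstRight)
            ≡⟨ arith₃ (cAS) (u lastLeft) (L x lastLeft) (L x firstRight) (R s y firstRight) (e firstRight) (u right) (L x right) δ (u firstRight) ⟩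
          cAS + (L x lastLeft + R s y firstRight) + L x right + (δ + (u firstRight + L x firstRight) + (u lastLeft + e firstRight + u right))
            ≡⟨ cong (_+ (δ + (u firstRight + L x firstRight) + (u lastLeft + e firstRight + u right))) as ⟩
          cWA + (x + y) + (δ + (u firstRight + L x firstRight) + (u lastLeft + e firstRight + u right))
            ≡⟨ arith₄ (cWA) x y δ _ _ ⟩
          cWA + (δ + x + y) + (u firstRight + L x firstRight) + (u lastLeft + e firstRight + u right)
            ≡⟨ cong₂ (λ a b → cWA + a + b + (u lastLeft + e firstRight + u right)) (trans (cong (_+ y) (sym s≡)) tot) (sym (head-eq firstRight)) ⟩
          cWA + N + Head′ firstRight + (u lastLeft + e firstRight + u right) ∎)
        (≤-trans (+-mono-≤ δ≤1 (u≤1 firstRight (λ a → χ≤1 _))) (s≤s (s≤s z≤n)))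
        (+-mono-≤ (+-mono-≤ (u≤1 lastLeft (λ a → χ≤1 _)) (e≤1 firstRight (λ a → χ≤1 _))) (u≤1 right (λ a → χ≤1 _)))
      where
      open ≡-Reasoning
      δ : ℕ
      δ = s ∸ x
      s≡ : s ≡ δ + x
      s≡ = sym (m∸n+n≡m x≤s)
      δ≤1 : δ ≤ 1
      δ≤1 = ≤-trans (∸-monoˡ-≤ x s≤) (≤-reflexive (m+n∸n≡m 1 x))
      -- `e f` is the share of the unread element, if any, in the full sum; `u f` is its share in
      -- the head sum, present only if it is a left element.
      e u : (ℕ → ℕ) → ℕ
      e f = δ * f (g x)
      u f = e left * f (g x)
      e≤1 : ∀ f → (∀ a → f a ≤ 1) → e f ≤ 1
      e≤1 f h = *-≤1 δ≤1 (h (g x))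
      u≤1 : ∀ f → (∀ a → f a ≤ 1) → u f ≤ 1
      u≤1 f h = *-≤1 (e≤1 left (λ a → χ≤1 _)) (h (g x))
      w≤k : e w ≤ suc k
      w≤k = *-≤1 δ≤1 (subst (w (g x) ≤_) m+r (w≤ (g x) (subst (g x <_) (sym m+r) (s≤s (g≤k x)))))
      all-eq : ∀ f → Full′ f ≡ L x f + R s y f + e f
      all-eq f = trans (cong (λ c → L c f) (sym tot)) (trans (∑-split s y _)
        (trans (cong (_+ R s y f) (trans (cong (λ c → L c f) s≡) (L-gap x δ f δ≤1))) (lem (e f) (L x f) (R s y f))))
        where
        lem : ∀ a b c → a + b + c ≡ b + c + a
        lem = solve-∀
      -- By balance, the left elements read by `j` are as many as the right elements read by `i`, so
      -- the left elements read number exactly `x`.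
      ℓ≡ : Full′ left ≡ e left + x
      ℓ≡ = trans (all-eq left) (trans (cong (_+ e left) (trans (cong (L x left +_) (sym bal)) (L-left+right x))) (+-comm x (e left)))
      ℓ≤N : Full′ left ≤ N
      ℓ≤N = ≤-trans (∑-mono N (λ t _ → χ≤1 _)) (≤-reflexive (trans (∑-const N 1) (*-identityʳ N)))
      head-eq : ∀ f → Head′ f ≡ u f + L x f
      head-eq f = trans (∑-prefix N (Full′ left) (λ r → f (g r)) ℓ≤N)
        (trans (cong (λ c → L c f) ℓ≡) (L-gap x (e left) f (e≤1 left (λ a → χ≤1 _))))
      arith₁ : ∀ W ul ll lf rf ef ew uf → W + (ul + ll) + (lf + rf + ef) + (ew + uf) ≡ W + (ll + rf) + (ew + (uf + lf) + (ul + ef))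
      arith₁ = solve-∀
      arith₂ : ∀ a b c d → a + (b + c + d) ≡ a + b + c + d
      arith₂ = solve-∀
      arith₃ : ∀ A ul ll lf rf ef ur lr d uf → A + (ul + ll) + (lf + rf + ef) + (ur + lr) + (d + uf)
        ≡ A + (ll + rf) + lr + (d + (uf + lf) + (ul + ef + ur))
      arith₃ = solve-∀
      arith₄ : ∀ W x y d a b → W + (x + y) + (d + a + b) ≡ W + (d + x + y) + a + b
      arith₄ = solve-∀

    estimates : Close (suc k) (costSE n) (Full′ w)
      × Close (suc (suc k)) (costWA n + Head′ lastLeft + Full′ firstRight) (Full′ w + Head′ firstRight)
      × Close 3 (costAS n + Head′ lastLeft + Full′ firstRight + Head′ right) (costWA n + N + Head′ firstRight)
    estimates = let x , s , y , x≤s , s≤ , tot , se , wa , as , bal = costs in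
      combine x s y x≤s s≤ tot se wa as bal

  open import Data.Integer using (+_)

  -- Asymptotics

  opaque
    unfolding S

    S-+ : ∀ n F H → S n (λ B → F B + H B) ≡ S n F + S n H
    S-+ n F H = sumOver-+ (allPerms n) _ _

    S-≤ : ∀ n C {F H} → (∀ B → F B ≤ H B + C) → S n F ≤ S n H + C * #perms n
    S-≤ n C {F} {H} le = go (allPerms n)
      where
      go : ∀ xss → sumOver xss (λ xs → F (nth xs)) ≤ sumOver xss (λ xs → H (nth xs)) + C * length xss
      go []         = z≤n
      go (xs ∷ xss) = ≤-trans (+-mono-≤ (le (nth xs)) (go xss)) (≤-reflexive (lem (H (nth xs)) C _ (length xss)))
        where
        lem : ∀ h c s l → h + c + (s + c * l) ≡ h + s + c * suc l
        lem = solve-∀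

    S-def : ∀ n F → S n F ≡ sum (map (λ xs → F (nth xs)) (allPerms n))
    S-def n F = refl

  S-Close : ∀ n C {F H} → (∀ B → Close C (F B) (H B)) → Close (C * #perms n) (S n F) (S n H)
  S-Close n C c = S-≤ n C (λ B → proj₁ (c B)) , S-≤ n C (λ B → proj₂ (c B))

  opaque
    unfolding rank ∑

    countLess≡rank : ∀ B x t → countLess (λ i → B (i ∸ 1)) x t ≡ rank B t x
    countLess≡rank B x zero    = refl
    countLess≡rank B x (suc t) = cong (_+_ (χ (B t <ᵇ x))) (countLess≡rank B x t)

  insAll-nonempty : ∀ x ys → ∃₂ λ zs zss → insAll x ys ≡ zs ∷ zss
  insAll-nonempty x []       = _ , _ , refl
  insAll-nonempty x (y ∷ ys) = _ , _ , refl

  perms-nonempty : ∀ xs → ∃₂ λ ys yss → perms xs ≡ ys ∷ yss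
  perms-nonempty []       = _ , _ , refl
  perms-nonempty (x ∷ xs) with perms xs | perms-nonempty xs
  ... | _ | ys , yss , refl with insAll x ys | insAll-nonempty x ys
  ...   | _ | _ , _ , refl = _ , _ , refl

  opaque
    unfolding S

    length-allPerms : ∀ n → length (allPerms n) ≡ #perms n
    length-allPerms n = refl

    -- Ensures that `mean` is a genuine quotient and not its default value 0 for the empty list.
    #perms-positive : ∀ n → ∃ λ t → #perms n ≡ suc t
    #perms-positive n with perms (map suc (upTo n)) | perms-nonempty (map suc (upTo n))
    ... | _ | _ , _ , refl = _ , refl

  mean≡ : ∀ ys {t} → length ys ≡ suc t → mean ys ≡ (+ sum ys) ℚ./ suc t
  mean≡ (y ∷ ys) refl = refl

  -- Over unnormalised rationals no common factors are cancelled, so the claim becomes an integer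
  -- inequality: the difference has numerator at most `C * suc t` in absolute value over the
  -- denominator `suc t * suc d`.
  ratio-bound : ∀ s t a d n C → ℤ.∣ + suc d ℤ.* s ℤ.- a ℤ.* n ℤ.* + suc t ∣ ≤ C * suc t →
    ℚ.∣ s ℚ./ suc t ℚ.- a ℚ./ suc d ℚ.* (n ℚ./ 1) ∣ ℚ.≤ + C ℚ./ 1
  ratio-bound s t a d n C h = ℚ.toℚᵘ-cancel-≤
    (ℚᵘ.≤-respʳ-≃ (ℚᵘ.≃-sym (ℚ.toℚᵘ-fromℚᵘ (mkℚᵘ (+ C) 0)))
    (ℚᵘ.≤-respˡ-≃ (ℚᵘ.≃-sym unnormalise) (*≤* core)))
    where
    p = s ℚ./ suc t
    q = a ℚ./ suc d
    r = n ℚ./ 1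
    unnormalise : ℚ.toℚᵘ ℚ.∣ p ℚ.- q ℚ.* r ∣ ℚᵘ.≃ ℚᵘ.∣ mkℚᵘ s t ℚᵘ.- mkℚᵘ a d ℚᵘ.* mkℚᵘ n 0 ∣
    unnormalise = ℚᵘ.≃-trans (ℚ.toℚᵘ-homo-∣-∣ (p ℚ.- q ℚ.* r)) (ℚᵘ.∣-∣-cong
      (ℚᵘ.≃-trans (ℚ.toℚᵘ-homo-+ p (ℚ.- (q ℚ.* r))) (ℚᵘ.+-cong (ℚ.toℚᵘ-fromℚᵘ (mkℚᵘ s t))
        (ℚᵘ.≃-trans (ℚ.toℚᵘ-homo‿- (q ℚ.* r)) (ℚᵘ.-‿cong
          (ℚᵘ.≃-trans (ℚ.toℚᵘ-homo-* q r) (ℚᵘ.*-cong (ℚ.toℚᵘ-fromℚᵘ (mkℚᵘ a d)) (ℚ.toℚᵘ-fromℚᵘ (mkℚᵘ n 0)))))))))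
    numerator : s ℤ.* + (suc d * 1) ℤ.+ ℤ.- (a ℤ.* n) ℤ.* + suc t ≡ + suc d ℤ.* s ℤ.- a ℤ.* n ℤ.* + suc t
    numerator = trans (cong (λ x → s ℤ.* + x ℤ.+ ℤ.- (a ℤ.* n) ℤ.* + suc t) (*-identityʳ (suc d))) (lem s (+ suc d) a n (+ suc t))
      where
      lem : ∀ s D a n T → s ℤ.* D ℤ.+ ℤ.- (a ℤ.* n) ℤ.* T ≡ D ℤ.* s ℤ.+ ℤ.- (a ℤ.* n ℤ.* T)
      lem = ℤ-Ring.solve-∀
    core : + ℤ.∣ s ℤ.* + (suc d * 1) ℤ.+ ℤ.- (a ℤ.* n) ℤ.* + suc t ∣ ℤ.* + 1 ℤ.≤ + C ℤ.* + (suc t * (suc d * 1))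
    core = ℤ.≤-trans (ℤ.≤-reflexive (trans (ℤ.*-identityʳ _) (cong (λ z → + ℤ.∣ z ∣) numerator)))
      (ℤ.≤-trans (ℤ.+≤+ (≤-trans h (*-monoʳ-≤ C (m≤m*n (suc t) (suc d * 1)))))
        (ℤ.≤-reflexive (ℤ.pos-* C (suc t * (suc d * 1)))))

  ∣-∣-close : ∀ {C a b} → Close C a b → ℤ.∣ + a ℤ.- + b ∣ ≤ C
  ∣-∣-close {C} {a} {b} (p , q) = ≤-trans (≤-reflexive (cong ℤ.∣_∣ (ℤ.m-n≡m⊖n a b))) (cases (≤-total a b))
    where
    cases : a ≤ b ⊎ b ≤ a → ℤ.∣ a ℤ.⊖ b ∣ ≤ C
    cases (inj₁ a≤b) = ≤-trans (≤-reflexive (ℤ.∣⊖∣-≤ a≤b)) (m≤n+o⇒m∸n≤o b a q)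
    cases (inj₂ b≤a) = ≤-trans (≤-reflexive (cong ℤ.∣_∣ (ℤ.≤-⊖ b≤a))) (m≤n+o⇒m∸n≤o a b p)

  module Asymptotics (k : ℕ) (1≤k : 1 ≤ k) where

    m r : ℕ
    m = mOf k
    r = suc k ∸ m

    len : ℕ → ℕ
    len N′ = k + suc (suc N′)

    perm# : ℕ → ℕ
    perm# N′ = #perms (len N′)

    -- Common denominator of the laws of one group and of two groups; every linear coefficient is an
    -- integer over `D`.
    D : ℤ
    D = + suc k ℤ.* + suc (suc k)

    -- Being `O(1)` after division by the number of permutations, with `C` uniform in the input
    -- size.
    record Small (X : ℕ → ℤ) : Set where
      constructor small
      field
        C     : ℕ
        bound : ∀ N′ → ℤ.∣ X N′ ∣ ≤ C * perm# N′

    Small-+ : ∀ {X Y} → Small X → Small Y → Small (λ N′ → X N′ ℤ.+ Y N′)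
    Small-+ {X} {Y} (small C p) (small C′ q) = small (C + C′) λ N′ → ≤-trans (ℤ.∣i+j∣≤∣i∣+∣j∣ (X N′) (Y N′))
      (≤-trans (+-mono-≤ (p N′) (q N′)) (≤-reflexive (sym (*-distribʳ-+ (perm# N′) C C′))))

    Small-neg : ∀ {X} → Small X → Small (λ N′ → ℤ.- X N′)
    Small-neg {X} (small C p) = small C λ N′ → ≤-trans (≤-reflexive (ℤ.∣-i∣≡∣i∣ (X N′))) (p N′)

    Small-* : ∀ c {X} → Small X → Small (λ N′ → c ℤ.* X N′)
    Small-* c {X} (small C p) = small (ℤ.∣ c ∣ * C) λ N′ → ≤-trans (≤-reflexive (ℤ.abs-* c (X N′)))
      (≤-trans (*-monoʳ-≤ ℤ.∣ c ∣ (p N′)) (≤-reflexive (sym (*-assoc ℤ.∣ c ∣ C (perm# N′)))))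

    Small-resp : ∀ {X Y} → (∀ N′ → X N′ ≡ Y N′) → Small X → Small Y
    Small-resp e (small C p) = small C λ N′ → subst (λ z → ℤ.∣ z ∣ ≤ C * perm# N′) (e N′) (p N′)

    Small-const : ∀ {X} c → (∀ N′ → X N′ ≡ c ℤ.* + perm# N′) → Small X
    Small-const c e = small ℤ.∣ c ∣ λ N′ → ≤-reflexive (trans (cong ℤ.∣_∣ (e N′)) (ℤ.abs-* c (+ perm# N′)))

    -- X N′ / perm# N′ = (a / D) · len N′ + O(1), with denominators cleared.
    record Lin (X : ℕ → ℤ) (a : ℤ) : Set where
      constructor lin
      field
        error : Small (λ N′ → D ℤ.* X N′ ℤ.- a ℤ.* + len N′ ℤ.* + perm# N′)

    Lin-+ : ∀ {X Y a b} → Lin X a → Lin Y b → Lin (λ N′ → X N′ ℤ.+ Y N′) (a ℤ.+ b)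
    Lin-+ {X} {Y} {a} {b} (lin p) (lin q) = lin (Small-resp (λ N′ → lem D (X N′) (Y N′) a b (+ len N′) (+ perm# N′)) (Small-+ p q))
      where
      lem : ∀ D X Y a b n t → (D ℤ.* X ℤ.+ ℤ.- (a ℤ.* n ℤ.* t)) ℤ.+ (D ℤ.* Y ℤ.+ ℤ.- (b ℤ.* n ℤ.* t))
        ≡ D ℤ.* (X ℤ.+ Y) ℤ.+ ℤ.- ((a ℤ.+ b) ℤ.* n ℤ.* t)
      lem = ℤ-Ring.solve-∀

    Lin-neg : ∀ {X a} → Lin X a → Lin (λ N′ → ℤ.- X N′) (ℤ.- a)
    Lin-neg {X} {a} (lin p) = lin (Small-resp (λ N′ → lem D (X N′) a (+ len N′) (+ perm# N′)) (Small-neg p))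
      where
      lem : ∀ D X a n t → ℤ.- (D ℤ.* X ℤ.+ ℤ.- (a ℤ.* n ℤ.* t)) ≡ D ℤ.* (ℤ.- X) ℤ.+ ℤ.- ((ℤ.- a) ℤ.* n ℤ.* t)
      lem = ℤ-Ring.solve-∀

    Lin-small : ∀ {X Y a} → Small (λ N′ → X N′ ℤ.- Y N′) → Lin Y a → Lin X a
    Lin-small {X} {Y} {a} p (lin q) = lin (Small-resp (λ N′ → lem D (X N′) (Y N′) (a ℤ.* + len N′ ℤ.* + perm# N′)) (Small-+ (Small-* D p) q))
      where
      lem : ∀ D X Y c → D ℤ.* (X ℤ.+ ℤ.- Y) ℤ.+ (D ℤ.* Y ℤ.+ ℤ.- c) ≡ D ℤ.* X ℤ.+ ℤ.- c
      lem = ℤ-Ring.solve-∀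

    +* : ∀ a b → + (a * b) ≡ + a ℤ.* + b
    +* = ℤ.pos-*

    sFull : (ℕ → ℕ) → ℕ → ℤ
    sFull f N′ = + S (len N′) (Groups.Full k N′ f)

    -- The expectation is exactly `N c / (k+1)`; the bounded error comes only from replacing `N` by
    -- `n = k + N`.
    Lin-Full : ∀ f {c} → ∑ (suc k) f ≡ c → Lin (sFull f) (+ suc (suc k) ℤ.* + c)
    Lin-Full f {c} refl = lin (Small-const (ℤ.- (+ suc (suc k) ℤ.* + c ℤ.* + k))
      (λ N′ → lem (+ suc k) (+ suc (suc k)) (+ suc (suc N′)) (sFull f N′) (+ perm# N′) (+ c) (+ k) (exact N′)))
      where
      open ≡-Reasoning
      exact : ∀ N′ → + suc k ℤ.* sFull f N′ ≡ + suc (suc N′) ℤ.* (+ perm# N′ ℤ.* + c)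
      exact N′ = begin
        + suc k ℤ.* sFull f N′                         ≡⟨ +* (suc k) _ ⟨
        + (suc k * S (len N′) (Groups.Full k N′ f))    ≡⟨ cong +_ (Groups.E-Full k N′ f) ⟩
        + (suc (suc N′) * (perm# N′ * c))              ≡⟨ +* (suc (suc N′)) (perm# N′ * c) ⟩
        + suc (suc N′) ℤ.* + (perm# N′ * c)            ≡⟨ cong (+ suc (suc N′) ℤ.*_) (+* (perm# N′) c) ⟩
        + suc (suc N′) ℤ.* (+ perm# N′ ℤ.* + c)        ∎
      lem : ∀ K₁ K₂ N s t c k → K₁ ℤ.* s ≡ N ℤ.* (t ℤ.* c) →
        K₁ ℤ.* K₂ ℤ.* s ℤ.+ ℤ.- (K₂ ℤ.* c ℤ.* (k ℤ.+ N) ℤ.* t) ≡ ℤ.- (K₂ ℤ.* c ℤ.* k) ℤ.* t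
      lem K₁ K₂ N s t c k e = trans (lem₁ K₁ K₂ s (K₂ ℤ.* c ℤ.* (k ℤ.+ N) ℤ.* t))
        (trans (cong (λ z → K₂ ℤ.* z ℤ.+ ℤ.- (K₂ ℤ.* c ℤ.* (k ℤ.+ N) ℤ.* t)) e) (lem₂ K₂ N t c k))
        where
        lem₁ : ∀ K₁ K₂ s z → K₁ ℤ.* K₂ ℤ.* s ℤ.+ ℤ.- z ≡ K₂ ℤ.* (K₁ ℤ.* s) ℤ.+ ℤ.- z
        lem₁ = ℤ-Ring.solve-∀
        lem₂ : ∀ K₂ N t c k → K₂ ℤ.* (N ℤ.* (t ℤ.* c)) ℤ.+ ℤ.- (K₂ ℤ.* c ℤ.* (k ℤ.+ N) ℤ.* t) ≡ ℤ.- (K₂ ℤ.* c ℤ.* k) ℤ.* t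
        lem₂ = ℤ-Ring.solve-∀

    open Weights m
    open WeightSums m r

    module GroupsOf (N′ : ℕ) where
      open Groups k N′ public
      open Head left (λ a → χ≤1 _) public using (Head; E-Head)

    sHead : (ℕ → ℕ) → ℕ → ℤ
    sHead f N′ = + S (len N′) (GroupsOf.Head N′ f)

    -- In `E-Head` the input size enters only through the factor `suc N′ = n - k - 1` of `v`, so `v`
    -- is the coefficient over `D`; the remaining terms are bounded.
    Lin-Head : ∀ f {u v} → ∑ (suc k) (λ a → left a * f a) ≡ u → ∑ (suc k) left * ∑ (suc k) f + u ≡ v → Lin (sHead f) (+ v)
    Lin-Head f {u} {v} refl refl = lin (Small-const (+ suc (suc k) ℤ.* + u ℤ.- + v ℤ.* (+ k ℤ.+ + 1))
      (λ N′ → lem (+ suc k) (+ suc (suc k)) (+ suc N′) (sHead f N′) (+ perm# N′) (+ u) (+ v) (+ k) (exact N′)))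
      where
      open ≡-Reasoning
      exact : ∀ N′ → + suc k ℤ.* (+ suc (suc k) ℤ.* sHead f N′) ≡ + perm# N′ ℤ.* (+ suc (suc k) ℤ.* + u ℤ.+ + suc N′ ℤ.* + v)
      exact N′ = begin
        + suc k ℤ.* (+ suc (suc k) ℤ.* sHead f N′)
          ≡⟨ cong (+ suc k ℤ.*_) (+* (suc (suc k)) sH) ⟨
        + suc k ℤ.* + (suc (suc k) * sH)
          ≡⟨ +* (suc k) (suc (suc k) * sH) ⟨
        + (suc k * (suc (suc k) * sH))
          ≡⟨ cong +_ (GroupsOf.E-Head N′ f) ⟩
        + (perm# N′ * (suc (suc k) * u + suc N′ * v))
          ≡⟨ +* (perm# N′) _ ⟩
        + perm# N′ ℤ.* (+ (suc (suc k) * u) ℤ.+ + (suc N′ * v))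
          ≡⟨ cong₂ (λ x y → + perm# N′ ℤ.* (x ℤ.+ y)) (+* (suc (suc k)) u) (+* (suc N′) v) ⟩
        + perm# N′ ℤ.* (+ suc (suc k) ℤ.* + u ℤ.+ + suc N′ ℤ.* + v) ∎
        where
        sH : ℕ
        sH = S (len N′) (GroupsOf.Head N′ f)
      lem : ∀ K₁ K₂ M s t u v k → K₁ ℤ.* (K₂ ℤ.* s) ≡ t ℤ.* (K₂ ℤ.* u ℤ.+ M ℤ.* v) →
        K₁ ℤ.* K₂ ℤ.* s ℤ.+ ℤ.- (v ℤ.* (k ℤ.+ (+ 1 ℤ.+ M)) ℤ.* t) ≡ (K₂ ℤ.* u ℤ.+ ℤ.- (v ℤ.* (k ℤ.+ + 1))) ℤ.* t
      lem K₁ K₂ M s t u v k e = trans (cong (ℤ._+ ℤ.- (v ℤ.* (k ℤ.+ (+ 1 ℤ.+ M)) ℤ.* t)) (trans (ℤ.*-assoc K₁ K₂ s) e))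
        (lem₁ K₂ M t u v k)
        where
        lem₁ : ∀ K₂ M t u v k → t ℤ.* (K₂ ℤ.* u ℤ.+ M ℤ.* v) ℤ.+ ℤ.- (v ℤ.* (k ℤ.+ (+ 1 ℤ.+ M)) ℤ.* t)
          ≡ (K₂ ℤ.* u ℤ.+ ℤ.- (v ℤ.* (k ℤ.+ + 1))) ℤ.* t
        lem₁ = ℤ-Ring.solve-∀

    sConst : ℕ → ℤ
    sConst N′ = + S (len N′) (λ _ → suc (suc N′))

    Lin-N : Lin sConst D
    Lin-N = lin (Small-const (ℤ.- (D ℤ.* + k)) (λ N′ → trans
        (cong (λ z → D ℤ.* z ℤ.- D ℤ.* + len N′ ℤ.* + perm# N′) (trans (cong +_ (S-const (len N′) (suc (suc N′)))) (+* (perm# N′) _)))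
        (lem D (+ perm# N′) (+ suc (suc N′)) (+ k))))
      where
      lem : ∀ D t N k → D ℤ.* (t ℤ.* N) ℤ.+ ℤ.- (D ℤ.* (k ℤ.+ N) ℤ.* t) ≡ ℤ.- (D ℤ.* k) ℤ.* t
      lem = ℤ-Ring.solve-∀

    -- The index shift is that of `toArr`: at `B = nth xs` this is the cost on the list `xs`.
    costOf : ((k : ℕ) → Arr → ℕ → ℕ) → ℕ → (ℕ → ℕ) → ℕ
    costOf P N′ B = P k (λ t → B (t ∸ 1)) (len N′)

    sCost : ((k : ℕ) → Arr → ℕ → ℕ) → ℕ → ℤ
    sCost P N′ = + S (len N′) (costOf P N′)

    module _ (N′ : ℕ) (B : ℕ → ℕ) where
      private
        module Est = Estimates k 1≤k (λ t → B (t ∸ 1)) (suc (suc N′))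
        open GroupsOf N′ using (Full; Head)

      Full≡ : ∀ f → Est.Full′ f ≡ Full f B
      Full≡ f = ∑-cong (suc (suc N′)) (λ r _ → cong f (countLess≡rank B (B (k + r)) k))

      Head≡ : ∀ f → Est.Head′ f ≡ Head f B
      Head≡ f = ∑-cong (suc (suc N′)) (λ r _ → cong₂ (λ l x → χ (r <ᵇ l) * f x) (Full≡ left) (countLess≡rank B (B (k + r)) k))

      close-SE : Close (suc k) (costOf Exchange.costSE N′ B) (Full w B)
      close-SE = subst (Close (suc k) _) (Full≡ w) (proj₁ Est.estimates)

      close-WA : Close (suc (suc k)) (costOf Exchange.costWA N′ B + Head lastLeft B + Full firstRight B) (Full w B + Head firstRight B)
      close-WA = subst₂ (Close (suc (suc k)))
        (cong₂ (λ a b → costOf Exchange.costWA N′ B + a + b) (Head≡ lastLeft) (Full≡ firstRight))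
        (cong₂ _+_ (Full≡ w) (Head≡ firstRight)) (proj₁ (proj₂ Est.estimates))

      close-AS : Close 3 (costOf Exchange.costAS N′ B + Head lastLeft B + Full firstRight B + Head right B)
                         (costOf Exchange.costWA N′ B + suc (suc N′) + Head firstRight B)
      close-AS = subst₂ (Close 3)
        (cong₂ _+_ (cong₂ (λ a b → costOf Exchange.costAS N′ B + a + b) (Head≡ lastLeft) (Full≡ firstRight)) (Head≡ right))
        (cong (_+_ (costOf Exchange.costWA N′ B + suc (suc N′))) (Head≡ firstRight)) (proj₂ (proj₂ Est.estimates))

    Lin-SE : ∀ {W} → ∑ (suc k) w ≡ W → Lin (sCost Exchange.costSE) (+ suc (suc k) ℤ.* + W)
    Lin-SE e = Lin-small (small (suc k) λ N′ → ∣-∣-close (S-Close (len N′) (suc k) (close-SE N′))) (Lin-Full w e)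

    S₃ : ∀ n F H J → S n (λ B → F B + H B + J B) ≡ S n F + S n H + S n J
    S₃ n F H J = trans (S-+ n (λ B → F B + H B) J) (cong (_+ S n J) (S-+ n F H))

    m+r : m + r ≡ suc k
    m+r = m+[n∸m]≡n (m≤n⇒m≤1+n (Partition.h<k k 1≤k (λ _ → 0) 0))

    h<1+k : ⌊ k /2⌋ < suc k
    h<1+k = s≤s (<⇒≤ (Partition.h<k k 1≤k (λ _ → 0) 0))

    m<1+k : m < suc k
    m<1+k = s≤s (Partition.h<k k 1≤k (λ _ → 0) 0)

    ∑-left′ : ∑ (suc k) left ≡ m
    ∑-left′ = subst (λ c → ∑ c left ≡ m) m+r ∑-left

    -- The product of the two class sizes gives `m`, and the diagonal term gives 1 because group
    -- `m - 1` is itself a left group. For `firstRight` and `right` the diagonal term vanishes.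
    Lin-Head-lastLeft : Lin (sHead lastLeft) (+ (m + 1))
    Lin-Head-lastLeft = Lin-Head lastLeft
      (trans (∑-cong (suc k) (λ a _ → *-comm (left a) (lastLeft a)))
        (trans (∑-point (suc k) ⌊ k /2⌋ left h<1+k) (<ᵇ-yes {⌊ k /2⌋} ≤-refl)))
      (cong (_+ 1) (trans (cong₂ _*_ ∑-left′ (∑-point-1 (suc k) ⌊ k /2⌋ h<1+k)) (*-identityʳ m)))

    Lin-Head-firstRight : Lin (sHead firstRight) (+ m)
    Lin-Head-firstRight = Lin-Head firstRight
      (trans (∑-cong (suc k) (λ a _ → *-comm (left a) (firstRight a)))
        (trans (∑-point (suc k) m left m<1+k) (<ᵇ-no {m} ≤-refl)))
      (trans (+-identityʳ _) (trans (cong₂ _*_ ∑-left′ (∑-point-1 (suc k) m m<1+k)) (*-identityʳ m)))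

    Lin-Head-right : Lin (sHead right) (+ (m * r))
    Lin-Head-right = Lin-Head right
      (subst (λ c → ∑ c (λ a → left a * right a) ≡ 0) m+r ∑-left-right)
      (trans (+-identityʳ _) (cong₂ _*_ ∑-left′ (subst (λ c → ∑ c right ≡ r) m+r ∑-right)))

    Lin-Full-firstRight : Lin (sFull firstRight) (+ suc (suc k) ℤ.* + 1)
    Lin-Full-firstRight = Lin-Full firstRight (∑-point-1 (suc k) m m<1+k)

    -- Weights minus stays: group `m - 1` stays when read from the left (`Head`), group `m` when
    -- read from the right (`Full` minus `Head`). `aAS` adds the number of rotations: `D` for the
    -- reads, the stays once more, and `m * r` for the swaps.
    aWA : ℕ → ℤ
    aWA W = + suc (suc k) ℤ.* + W ℤ.+ + m ℤ.+ ℤ.- (+ (m + 1)) ℤ.+ ℤ.- (+ suc (suc k) ℤ.* + 1)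

    aAS : ℕ → ℤ
    aAS W = aWA W ℤ.+ D ℤ.+ + m ℤ.+ ℤ.- (+ (m + 1)) ℤ.+ ℤ.- (+ suc (suc k) ℤ.* + 1) ℤ.+ ℤ.- (+ (m * r))

    Lin-WA : ∀ {W} → ∑ (suc k) w ≡ W → Lin (sCost Exchange.costWA) (aWA W)
    Lin-WA {W} e = Lin-small
      (Small-resp (λ N′ → lem (sCost Exchange.costWA N′) (sHead lastLeft N′) (sFull firstRight N′) (sFull w N′) (sHead firstRight N′))
        (small (suc (suc k)) λ N′ → ∣-∣-close (subst₂ (Close _) (S₃ (len N′) _ _ _) (S-+ (len N′) _ _) (S-Close (len N′) (suc (suc k)) (close-WA N′)))))
      (Lin-+ (Lin-+ (Lin-+ (Lin-Full w e) Lin-Head-firstRight) (Lin-neg Lin-Head-lastLeft)) (Lin-neg Lin-Full-firstRight))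
      where
      lem : ∀ x a b c d → x ℤ.+ a ℤ.+ b ℤ.+ ℤ.- (c ℤ.+ d) ≡ x ℤ.+ ℤ.- (c ℤ.+ d ℤ.+ ℤ.- a ℤ.+ ℤ.- b)
      lem = ℤ-Ring.solve-∀

    Lin-AS : ∀ {W} → ∑ (suc k) w ≡ W → Lin (sCost Exchange.costAS) (aAS W)
    Lin-AS {W} e = Lin-small
      (Small-resp (λ N′ → lem (sCost Exchange.costAS N′) (sHead lastLeft N′) (sFull firstRight N′) (sHead right N′)
                              (sCost Exchange.costWA N′) (sConst N′) (sHead firstRight N′))
        (small 3 λ N′ → ∣-∣-close (subst₂ (Close _)
          (trans (S-+ (len N′) _ _) (cong (_+ S (len N′) (GroupsOf.Head N′ right)) (S₃ (len N′) _ _ _)))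
          (S₃ (len N′) _ _ _) (S-Close (len N′) 3 (close-AS N′)))))
      (Lin-+ (Lin-+ (Lin-+ (Lin-+ (Lin-+ (Lin-WA e) Lin-N) Lin-Head-firstRight) (Lin-neg Lin-Head-lastLeft)) (Lin-neg Lin-Full-firstRight)) (Lin-neg Lin-Head-right))
      where
      lem : ∀ x a b c p q d → x ℤ.+ a ℤ.+ b ℤ.+ c ℤ.+ ℤ.- (p ℤ.+ q ℤ.+ d) ≡ x ℤ.+ ℤ.- (p ℤ.+ q ℤ.+ d ℤ.+ ℤ.- a ℤ.+ ℤ.- b ℤ.+ ℤ.- c)
      lem = ℤ-Ring.solve-∀

    -- The last hypothesis says `a / D = a′ / d′`. The threshold `suc (suc k)` provides the two
    -- non-pivots on which the moment formulas rest.
    toLinPlusO1 : ∀ P {a} a′ d′ → Lin (sCost P) a → 1 ≤ d′ → a ℤ.* + d′ ≡ a′ ℤ.* D →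
      LinPlusO1 (E (λ k n xs → P k (toArr xs) n) k) (frac a′ d′)
    toLinPlusO1 P {a} a′ (suc d) (lin (small C bound)) _ prop = (+ (suc d * C) ℚ./ 1) , suc (suc k) , λ n n≥ →
      subst (λ n → ℚ.∣ E P′ k n ℚ.- a′ ℚ./ suc d ℚ.* (+ n ℚ./ 1) ∣ ℚ.≤ + (suc d * C) ℚ./ 1)
        (n≡ n n≥) (main (n ∸ suc (suc k)))
      where
      P′ : ℕ → ℕ → List ℕ → ℕ
      P′ k n xs = P k (toArr xs) n
      n≡ : ∀ n → suc (suc k) ≤ n → len (n ∸ suc (suc k)) ≡ n
      n≡ n n≥ = trans (trans (+-suc k _) (cong suc (+-suc k _))) (m+[n∸m]≡n n≥)
      main : ∀ N′ → ℚ.∣ E P′ k (len N′) ℚ.- a′ ℚ./ suc d ℚ.* (+ len N′ ℚ./ 1) ∣ ℚ.≤ + (suc d * C) ℚ./ 1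
      main N′ = go (#perms-positive (len N′))
        where
        s : ℤ
        s = + sum (map (P′ k (len N′)) (allPerms (len N′)))
        go : (∃ λ t → #perms (len N′) ≡ suc t) → ℚ.∣ E P′ k (len N′) ℚ.- a′ ℚ./ suc d ℚ.* (+ len N′ ℚ./ 1) ∣ ℚ.≤ + (suc d * C) ℚ./ 1
        go (t , et) = subst (λ q → ℚ.∣ q ℚ.- a′ ℚ./ suc d ℚ.* (+ len N′ ℚ./ 1) ∣ ℚ.≤ + (suc d * C) ℚ./ 1)
          (sym (mean≡ (map (P′ k (len N′)) (allPerms (len N′))) (trans (length-map _ (allPerms (len N′))) (trans (length-allPerms (len N′)) et))))
          (ratio-bound s t a′ d (+ len N′) (suc d * C) scaled)
          where
          y : ℤ
          y = + suc d ℤ.* s ℤ.- a′ ℤ.* + len N′ ℤ.* + suc t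
          z : ℤ
          z = D ℤ.* s ℤ.- a ℤ.* + len N′ ℤ.* + suc t
          z≤ : ℤ.∣ z ∣ ≤ C * suc t
          z≤ = subst₂ (λ s t → ℤ.∣ D ℤ.* s ℤ.- a ℤ.* + len N′ ℤ.* + t ∣ ≤ C * t)
                 (cong +_ (S-def (len N′) (costOf P N′))) et (bound N′)
          -- Both sides are the same error brought to the denominators `D` and `suc d`. As `D ≥ 1`,
          -- the size of `y` is at most that of `D * y`, hence at most `suc d` times that of `z`.
          yz : D ℤ.* y ≡ + suc d ℤ.* z
          yz = trans (lem₁ D (+ suc d) s a′ (+ len N′ ℤ.* + suc t) (a′ ℤ.* + len N′ ℤ.* + suc t) (ℤ.*-assoc a′ (+ len N′) (+ suc t)))
               (trans (cong (λ v → + suc d ℤ.* (D ℤ.* s) ℤ.- v ℤ.* (+ len N′ ℤ.* + suc t)) (sym prop))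
                 (lem₂ D (+ suc d) s a (+ len N′) (+ suc t)))
            where
            lem₀ : ∀ D d s a n → D ℤ.* (d ℤ.* s ℤ.+ ℤ.- (a ℤ.* n)) ≡ d ℤ.* (D ℤ.* s) ℤ.+ ℤ.- (a ℤ.* D ℤ.* n)
            lem₀ = ℤ-Ring.solve-∀
            lem₁ : ∀ D d s a n an → an ≡ a ℤ.* n → D ℤ.* (d ℤ.* s ℤ.+ ℤ.- an) ≡ d ℤ.* (D ℤ.* s) ℤ.+ ℤ.- (a ℤ.* D ℤ.* n)
            lem₁ D d s a n _ refl = lem₀ D d s a n
            lem₂ : ∀ D d s a n t → d ℤ.* (D ℤ.* s) ℤ.+ ℤ.- (a ℤ.* d ℤ.* (n ℤ.* t)) ≡ d ℤ.* (D ℤ.* s ℤ.+ ℤ.- (a ℤ.* n ℤ.* t))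
            lem₂ = ℤ-Ring.solve-∀
          scaled : ℤ.∣ y ∣ ≤ suc d * C * suc t
          scaled = ≤-trans (m≤n*m ℤ.∣ y ∣ (suc k * suc (suc k)))
            (≤-trans (≤-reflexive (trans (cong (_* ℤ.∣ y ∣) (sym (ℤ.abs-* (+ suc k) (+ suc (suc k))))) (trans (sym (ℤ.abs-* D y)) (trans (cong ℤ.∣_∣ yz) (ℤ.abs-* (+ suc d) z)))))
              (≤-trans (*-monoʳ-≤ (suc d) z≤) (≤-reflexive (sym (*-assoc (suc d) C (suc t))))))

  -- The coefficients as functions of `m`, for odd and for even `k`

  odd-half : ∀ k → k % 2 ≡ 1 → k ≡ suc (⌊ k /2⌋ + ⌊ k /2⌋)
  odd-half (suc zero)    _ = refl
  odd-half (suc (suc k)) e = cong (λ x → suc (suc x)) (trans (odd-half k e) (sym (+-suc ⌊ k /2⌋ ⌊ k /2⌋)))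

  even-half : ∀ k → k % 2 ≡ 0 → k ≡ ⌊ k /2⌋ + ⌊ k /2⌋
  even-half zero          _ = refl
  even-half (suc (suc k)) e = cong suc (trans (cong suc (even-half k e)) (sym (+-suc ⌊ k /2⌋ ⌊ k /2⌋)))

  module Coefficients (k : ℕ) (1≤k : 1 ≤ k) where

    open Asymptotics k 1≤k
    open Weights m
    open WeightSums m r

    h : ℕ
    h = ⌊ k /2⌋

    M H : ℤ
    M = + m
    H = + h

    aWA-cong : ∀ {W K W′} → + suc (suc k) ≡ K → + W ≡ W′ →
      aWA W ≡ K ℤ.* W′ ℤ.+ M ℤ.+ ℤ.- (M ℤ.+ + 1) ℤ.+ ℤ.- (K ℤ.* + 1)
    aWA-cong e f = cong₂ (λ K W → K ℤ.* W ℤ.+ M ℤ.+ ℤ.- (M ℤ.+ + 1) ℤ.+ ℤ.- (K ℤ.* + 1)) e f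

    aAS-cong : ∀ {W K₁ K W′ Q} → + suc k ≡ K₁ → + suc (suc k) ≡ K → + W ≡ W′ → + (m * r) ≡ Q →
      aAS W ≡ K ℤ.* W′ ℤ.+ M ℤ.+ ℤ.- (M ℤ.+ + 1) ℤ.+ ℤ.- (K ℤ.* + 1)
              ℤ.+ K₁ ℤ.* K ℤ.+ M ℤ.+ ℤ.- (M ℤ.+ + 1) ℤ.+ ℤ.- (K ℤ.* + 1) ℤ.+ ℤ.- Q
    aAS-cong {W} {K₁} {K} {W′} {Q} e₁ e f q = trans
      (cong₂ (λ u v → u ℤ.+ v ℤ.+ M ℤ.+ ℤ.- (M ℤ.+ + 1) ℤ.+ ℤ.- (+ suc (suc k) ℤ.* + 1) ℤ.+ ℤ.- (+ (m * r))) (aWA-cong {W} e f) (cong₂ ℤ._*_ e₁ e))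
      (cong₂ (λ u v → K ℤ.* W′ ℤ.+ M ℤ.+ ℤ.- (M ℤ.+ + 1) ℤ.+ ℤ.- (K ℤ.* + 1)
              ℤ.+ K₁ ℤ.* K ℤ.+ M ℤ.+ ℤ.- (M ℤ.+ + 1) ℤ.+ ℤ.- (u ℤ.* + 1) ℤ.+ ℤ.- v) e q)

    W≡ : ∀ {W} → m * suc m + r * suc r ≡ 2 * W → ∑ (suc k) w ≡ W
    W≡ {W} e = *-cancelˡ-≡ _ W 2 (trans (cong (λ c → 2 * ∑ c w) (sym m+r)) (trans ∑-w e))

    D≡ : ∀ {d} → d ≡ suc k * suc (suc k) → + d ≡ D
    D≡ e = trans (cong +_ e) (ℤ.pos-* (suc k) (suc (suc k)))

    module Odd (odd : k % 2 ≡ 1) where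

      1+k≡ : suc k ≡ m + m
      1+k≡ = trans (cong suc (odd-half k odd)) (cong suc (sym (+-suc h h)))

      2+k≡ : suc (suc k) ≡ m + m + 1
      2+k≡ = trans (cong suc 1+k≡) (+-comm 1 (m + m))

      r≡ : r ≡ m
      r≡ = trans (cong (_∸ m) 1+k≡) (m+n∸m≡n m m)

      W-odd : ∑ (suc k) w ≡ m * suc m
      W-odd = W≡ (trans (cong (λ r → m * suc m + r * suc r) r≡) (cong (_+_ (m * suc m)) (sym (+-identityʳ _))))

      W′ : + (m * suc m) ≡ M ℤ.* (+ 1 ℤ.+ M)
      W′ = ℤ.pos-* m (suc m)

      -- The stated denominator is `D` itself, so for write accesses and assignments it suffices to
      -- compare numerators; only the fraction for scanned elements has been reduced.
      d≡ : 2 * m * (2 * m + 1) ≡ suc k * suc (suc k)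
      d≡ = trans (lem m) (sym (cong₂ _*_ 1+k≡ 2+k≡))
        where
        lem : ∀ m → 2 * m * (2 * m + 1) ≡ (m + m) * (m + m + 1)
        lem = solve-∀

      SE : LinPlusO1 (E PSE k) (frac (M ℤ.+ + 1) 2)
      SE = toLinPlusO1 Exchange.costSE (M ℤ.+ + 1) 2 (Lin-SE W-odd) (s≤s z≤n)
        (trans (cong₂ (λ K W → K ℤ.* W ℤ.* + 2) (cong +_ 2+k≡) W′)
          (trans (lem M) (sym (cong₂ (λ a b → (M ℤ.+ + 1) ℤ.* (a ℤ.* b)) (cong +_ 1+k≡) (cong +_ 2+k≡)))))
        where
        lem : ∀ M → (M ℤ.+ M ℤ.+ + 1) ℤ.* (M ℤ.* (+ 1 ℤ.+ M)) ℤ.* + 2 ≡ (M ℤ.+ + 1) ℤ.* ((M ℤ.+ M) ℤ.* (M ℤ.+ M ℤ.+ + 1))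
        lem = ℤ-Ring.solve-∀

      WA : LinPlusO1 (E PWA k) (frac (+ 2 ℤ.* M ℤ.* M ℤ.* M ℤ.+ + 3 ℤ.* M ℤ.* M ℤ.- M ℤ.- + 2) (2 * m * (2 * m + 1)))
      WA = toLinPlusO1 Exchange.costWA
        (+ 2 ℤ.* M ℤ.* M ℤ.* M ℤ.+ + 3 ℤ.* M ℤ.* M ℤ.- M ℤ.- + 2)
        (2 * m * (2 * m + 1)) (Lin-WA W-odd) (s≤s z≤n)
        (cong₂ ℤ._*_ (trans (aWA-cong {m * suc m} (cong +_ 2+k≡) W′) (lem M)) (D≡ d≡))
        where
        lem : ∀ M → (M ℤ.+ M ℤ.+ + 1) ℤ.* (M ℤ.* (+ 1 ℤ.+ M)) ℤ.+ M ℤ.+ ℤ.- (M ℤ.+ + 1) ℤ.+ ℤ.- ((M ℤ.+ M ℤ.+ + 1) ℤ.* + 1)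
          ≡ + 2 ℤ.* M ℤ.* M ℤ.* M ℤ.+ + 3 ℤ.* M ℤ.* M ℤ.+ ℤ.- M ℤ.+ ℤ.- (+ 2)
        lem = ℤ-Ring.solve-∀

      AS : LinPlusO1 (E PAS k) (frac (+ 2 ℤ.* M ℤ.* M ℤ.* M ℤ.+ + 6 ℤ.* M ℤ.* M ℤ.- M ℤ.- + 4) (2 * m * (2 * m + 1)))
      AS = toLinPlusO1 Exchange.costAS
        (+ 2 ℤ.* M ℤ.* M ℤ.* M ℤ.+ + 6 ℤ.* M ℤ.* M ℤ.- M ℤ.- + 4)
        (2 * m * (2 * m + 1)) (Lin-AS W-odd) (s≤s z≤n)
        (cong₂ ℤ._*_ (trans (aAS-cong {m * suc m} (cong +_ 1+k≡) (cong +_ 2+k≡) W′ (trans (cong (λ r → + (m * r)) r≡) (ℤ.pos-* m m))) (lem M)) (D≡ d≡))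
        where
        lem : ∀ M → (M ℤ.+ M ℤ.+ + 1) ℤ.* (M ℤ.* (+ 1 ℤ.+ M)) ℤ.+ M ℤ.+ ℤ.- (M ℤ.+ + 1) ℤ.+ ℤ.- ((M ℤ.+ M ℤ.+ + 1) ℤ.* + 1)
            ℤ.+ (M ℤ.+ M) ℤ.* (M ℤ.+ M ℤ.+ + 1) ℤ.+ M ℤ.+ ℤ.- (M ℤ.+ + 1) ℤ.+ ℤ.- ((M ℤ.+ M ℤ.+ + 1) ℤ.* + 1) ℤ.+ ℤ.- (M ℤ.* M)
          ≡ + 2 ℤ.* M ℤ.* M ℤ.* M ℤ.+ + 6 ℤ.* M ℤ.* M ℤ.+ ℤ.- M ℤ.+ ℤ.- (+ 4)
        lem = ℤ-Ring.solve-∀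

    module Even (even : k % 2 ≡ 0) where

      1+k≡ : suc k ≡ m + h
      1+k≡ = cong suc (even-half k even)

      2+k≡ : suc (suc k) ≡ m + m
      2+k≡ = trans (cong suc 1+k≡) (sym (+-suc m h))

      r≡ : r ≡ h
      r≡ = trans (cong (_∸ m) 1+k≡) (m+n∸m≡n m h)

      W-even : ∑ (suc k) w ≡ m * m
      W-even = W≡ (trans (cong (λ r → m * suc m + r * suc r) r≡) (lem h))
        where
        lem : ∀ h → suc h * suc (suc h) + h * suc h ≡ 2 * (suc h * suc h)
        lem = solve-∀

      W′ : + (m * m) ≡ M ℤ.* M
      W′ = ℤ.pos-* m m

      -- 2m ∸ 1 reduces to h + (m + 0).
      2m-1≡ : 2 * m ∸ 1 ≡ m + h
      2m-1≡ = trans (cong (_+_ h) (+-identityʳ m)) (+-comm h m)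

      d≡ : 2 * m * (2 * m ∸ 1) ≡ suc k * suc (suc k)
      d≡ = trans (cong (2 * m *_) 2m-1≡) (trans (lem m (m + h)) (sym (cong₂ _*_ 1+k≡ 2+k≡)))
        where
        lem : ∀ m x → 2 * m * x ≡ x * (m + m)
        lem = solve-∀

      1≤d : ∀ {d} → d ≡ suc k * suc (suc k) → 1 ≤ d
      1≤d refl = s≤s z≤n

      SE : LinPlusO1 (E PSE k) (frac (M ℤ.* M) (2 * m ∸ 1))
      SE = toLinPlusO1 Exchange.costSE (M ℤ.* M) (2 * m ∸ 1) (Lin-SE W-even) (subst (1 ≤_) (sym 2m-1≡) (s≤s z≤n))
        (trans (cong₂ (λ W d → + suc (suc k) ℤ.* W ℤ.* + d) W′ (trans 2m-1≡ (sym 1+k≡)))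
          (lem M (+ suc k) (+ suc (suc k))))
        where
        lem : ∀ M x y → y ℤ.* (M ℤ.* M) ℤ.* x ≡ M ℤ.* M ℤ.* (x ℤ.* y)
        lem = ℤ-Ring.solve-∀

      WA : LinPlusO1 (E PWA k) (frac (+ 2 ℤ.* M ℤ.* M ℤ.* M ℤ.- + 2 ℤ.* M ℤ.- + 1) (2 * m * (2 * m ∸ 1)))
      WA = toLinPlusO1 Exchange.costWA
        (+ 2 ℤ.* M ℤ.* M ℤ.* M ℤ.- + 2 ℤ.* M ℤ.- + 1)
        (2 * m * (2 * m ∸ 1)) (Lin-WA W-even) (1≤d d≡)
        (cong₂ ℤ._*_ (trans (aWA-cong {m * m} (cong +_ 2+k≡) W′) (lem M)) (D≡ d≡))
        where
        lem : ∀ M → (M ℤ.+ M) ℤ.* (M ℤ.* M) ℤ.+ M ℤ.+ ℤ.- (M ℤ.+ + 1) ℤ.+ ℤ.- ((M ℤ.+ M) ℤ.* + 1)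
          ≡ + 2 ℤ.* M ℤ.* M ℤ.* M ℤ.+ ℤ.- (+ 2 ℤ.* M) ℤ.+ ℤ.- (+ 1)
        lem = ℤ-Ring.solve-∀

      AS : LinPlusO1 (E PAS k) (frac (+ 2 ℤ.* M ℤ.* M ℤ.* M ℤ.+ + 3 ℤ.* M ℤ.* M ℤ.- + 5 ℤ.* M ℤ.- + 2) (2 * m * (2 * m ∸ 1)))
      AS = toLinPlusO1 Exchange.costAS
        (+ 2 ℤ.* M ℤ.* M ℤ.* M ℤ.+ + 3 ℤ.* M ℤ.* M ℤ.- + 5 ℤ.* M ℤ.- + 2)
        (2 * m * (2 * m ∸ 1)) (Lin-AS W-even) (1≤d d≡)
        (cong₂ ℤ._*_ (trans (aAS-cong {m * m} (cong +_ 1+k≡) (cong +_ 2+k≡) W′ (trans (cong (λ r → + (m * r)) r≡) (ℤ.pos-* m h))) (lem H)) (D≡ d≡))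
        where
        -- Here `r = m - 1 = h`, so the number of swaps involves `m * h`; with `M = 1 + H` the
        -- identity is polynomial in `H` alone.
        lem : ∀ H → let M = + 1 ℤ.+ H in
          (M ℤ.+ M) ℤ.* (M ℤ.* M) ℤ.+ M ℤ.+ ℤ.- (M ℤ.+ + 1) ℤ.+ ℤ.- ((M ℤ.+ M) ℤ.* + 1)
            ℤ.+ (M ℤ.+ H) ℤ.* (M ℤ.+ M) ℤ.+ M ℤ.+ ℤ.- (M ℤ.+ + 1) ℤ.+ ℤ.- ((M ℤ.+ M) ℤ.* + 1) ℤ.+ ℤ.- (M ℤ.* H)
          ≡ + 2 ℤ.* M ℤ.* M ℤ.* M ℤ.+ + 3 ℤ.* M ℤ.* M ℤ.+ ℤ.- (+ 5 ℤ.* M) ℤ.+ ℤ.- (+ 2)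
        lem = ℤ-Ring.solve-∀

open import Data.Nat using (ℕ; _≤_; _%_)
open import Data.Integer using (ℤ; +_; _+_; _-_; _*_)
open import Data.Product using (_×_; _,_)
open import Relation.Binary.PropositionalEquality using (_≡_)

theorem7p1 : (k : ℕ) → 1 ≤ k →
  (k % 2 ≡ 1 →
      LinPlusO1 (E PSE k) (frac (+ (mOf k) + + 1) 2)
    × LinPlusO1 (E PWA k)
        (frac (+ 2 * + (mOf k) * + (mOf k) * + (mOf k) + + 3 * + (mOf k) * + (mOf k) - + (mOf k) - + 2)
              (2 Data.Nat.* mOf k Data.Nat.* (2 Data.Nat.* mOf k Data.Nat.+ 1)))
    × LinPlusO1 (E PAS k)
        (frac (+ 2 * + (mOf k) * + (mOf k) * + (mOf k) + + 6 * + (mOf k) * + (mOf k) - + (mOf k) - + 4)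
              (2 Data.Nat.* mOf k Data.Nat.* (2 Data.Nat.* mOf k Data.Nat.+ 1))))
  × (k % 2 ≡ 0 →
      LinPlusO1 (E PSE k) (frac (+ (mOf k) * + (mOf k)) (2 Data.Nat.* mOf k Data.Nat.∸ 1))
    × LinPlusO1 (E PWA k)
        (frac (+ 2 * + (mOf k) * + (mOf k) * + (mOf k) - + 2 * + (mOf k) - + 1)
              (2 Data.Nat.* mOf k Data.Nat.* (2 Data.Nat.* mOf k Data.Nat.∸ 1)))
    × LinPlusO1 (E PAS k)
        (frac (+ 2 * + (mOf k) * + (mOf k) * + (mOf k) + + 3 * + (mOf k) * + (mOf k) - + 5 * + (mOf k) - + 2)
              (2 Data.Nat.* mOf k Data.Nat.* (2 Data.Nat.* mOf k Data.Nat.∸ 1))))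
theorem7p1 k 1≤k =
    (λ odd → let open Analysis.Coefficients.Odd k 1≤k odd in SE , WA , AS)
  , (λ even → let open Analysis.Coefficients.Even k 1≤k even in SE , WA , AS)
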